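{- Let $p$ be a prime, $R\ge1$, and let $k\ge 2$ be an integer with $k\mid(p-1)$ such that, if $p$ is odd, $2k\mid(p^R-1)$. Let $\omega$ be a primitive element of $\mathbb{F}_{p^R}$ and $\Gamma=\mathrm{GPaley}(p^R,\frac{p^R-1}{k})$. Then $\Gamma$ is connected and $\mathrm{Aut}(\Gamma)=T\rtimes\langle\widehat{\omega}^k,\alpha\rangle\le A\Gamma L(1,p^R)$.
   Context: $\mathrm{GPaley}(p^R,\frac{p^R-1}{k})$ is the Cayley graph on the additive group $V=\mathbb{F}_{p^R}$ with connection set $S=\{\omega^{jk}:j\ge0\}$ ($\{u,v\}$ an edge iff $v-u\in S$). $T$ is the group of translations $v\mapsto v+x$ ($x\in V$), $\widehat{\omega}^k$ is the map $x\mapsto x\omega^k$, and $\alpha$ is the Frobenius automorphism $x\mapsto x^p$ of $\mathbb{F}_{p^R}$; $A\Gamma L(1,p^R)=T\rtimes\langle\widehat{\omega},\alpha\rangle$. -}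

module Defs where

open import Level using (Level; _⊔_)
open import Data.Nat using (ℕ; zero; suc) renaming (_*_ to _*ℕ_)
open import Data.Fin using (Fin)
open import Data.Product using (Σ; ∃; _×_)
open import Relation.Nullary using (¬_)
open import Relation.Binary.PropositionalEquality using (_≡_)
open import Algebra.Bundles using (CommutativeRing)

module _ {c ℓ : Level} (F : CommutativeRing c ℓ) where
  open CommutativeRing F

  pow : Carrier → ℕ → Carrier
  pow x zero = 1#
  pow x (suc n) = x * pow x n

  IsField : Set (c ⊔ ℓ)
  IsField = (¬ (1# ≈ 0#)) × (∀ x → ¬ (x ≈ 0#) → ∃ λ y → x * y ≈ 1#)

  HasSize : ℕ → Set (c ⊔ ℓ)
  HasSize n = Σ (Carrier → Fin n) λ to → Σ (Fin n → Carrier) λ from →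
    (∀ x y → x ≈ y → to x ≡ to y) × (∀ x → from (to x) ≈ x) × (∀ i → to (from i) ≡ i)

  IsPrimitive : Carrier → Set (c ⊔ ℓ)
  IsPrimitive ω = ∀ x → ¬ (x ≈ 0#) → ∃ λ j → x ≈ pow ω j

  Congruent : (Carrier → Carrier) → Set (c ⊔ ℓ)
  Congruent f = ∀ x y → x ≈ y → f x ≈ f y

  -- GPaley(p^R, (p^R-1)/k): Cayley graph with connection set S = {ω^(jk) : j ≥ 0}
  module GPaley (ω : Carrier) (k : ℕ) where

    Adj : Carrier → Carrier → Set ℓ
    Adj u v = ∃ λ j → v - u ≈ pow ω (j *ℕ k)

    data Walk : Carrier → Carrier → Set (c ⊔ ℓ) where
      here : ∀ {u v} → u ≈ v → Walk u v
      step : ∀ {u w v} → Adj u w → Walk w v → Walk u v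

    Connected : Set (c ⊔ ℓ)
    Connected = ∀ u v → Walk u v

    IsAut : (Carrier → Carrier) → Set (c ⊔ ℓ)
    IsAut f = Congruent f
      × (Σ (Carrier → Carrier) λ g → Congruent g × (∀ x → g (f x) ≈ x) × (∀ x → f (g x) ≈ x))
      × (∀ u v → (Adj u v → Adj (f u) (f v)) × (Adj (f u) (f v) → Adj u v))

    -- the group T ⋊ ⟨ ω̂^k , α ⟩ generated by translations, x ↦ x ω^k and
    -- the Frobenius x ↦ x^p, as a set of maps (closed under ≈-pointwise equality)
    data InGroup (p : ℕ) : (Carrier → Carrier) → Set (c ⊔ ℓ) where
      translation : ∀ x → InGroup p (λ v → v + x)
      mulωk : InGroup p (λ v → v * pow ω k)
      frobenius : InGroup p (λ v → pow v p)
      compose : ∀ {f g} → InGroup p f → InGroup p g → InGroup p (λ v → f (g v))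
      inverse : ∀ {g h} → InGroup p g → Congruent h
        → (∀ x → h (g x) ≈ x) → (∀ x → g (h x) ≈ x) → InGroup p h
      extensional : ∀ {g h} → InGroup p g → (∀ x → g x ≈ h x) → InGroup p h

{-# OPTIONS --safe #-}
module Submission where

-- Write q = p^R, p - 1 = k e and m = (q - 1) / k, so that S = {z : z^m = 1} and the base-p digits of m
-- all equal e.  Since power sums over F vanish except in degree q - 1, convolving a polynomial of degree
-- j in z^m with the kernel B(z) = ∑_{i<k} z^(im), which only depends on whether z is 0, in S or elsewhere,
-- lowers the degree to j - 1; the leading coefficient survives because C(jm, m) ≠ 0 in F by Lucas' theorem.
-- Starting from B this produces a nonzero constant, so every vertex is reached by a walk, and a polynomial
-- a z^m + b invariant under every automorphism f, so that (f x - f y)^m = (x - y)^m for all x and y.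
--
-- Normalise f 0 = 0 and f 1 = 1.  Expressing f^t through the polynomials (x - v)^m shows deg f^t ≤ m for
-- every t whose base-p digits are at most e.  As 2m < q, multiplying up the powers f^(p^l) causes no
-- reduction modulo x^q - x, so the degrees d_l of the f^(p^l) satisfy ∑ d_l ≤ 1 + p + ... + p^(R-1).  If
-- f has the least degree among the f^(p^l), then d_l = p^l d_0 as long as this is below q, which forces
-- d_0 = 1.  Hence some f^(p^l) is the identity, and f is the inverse of a power of Frobenius.

open import Defs
open import Level using (Level; _⊔_)
open import Algebra.Bundles using (CommutativeRing)
open import Data.Empty using (⊥-elim)
open import Data.Fin as Fin using (Fin; zero; suc; toℕ; fromℕ<; punchOut)
import Data.Fin.Properties as Finₚ
open import Data.Fin.Permutation using (Permutation; permutation; _⟨$⟩ʳ_)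
open import Data.Nat as ℕ using (ℕ; zero; suc; _!; _≤_; _<_; z≤n; s≤s; _∸_; _≥_; NonZero) renaming (_+_ to _+ℕ_; _*_ to _*ℕ_; _^_ to _^ℕ_)
open import Data.Nat.Combinatorics using (_C_; nCk+nC[k+1]≡[n+1]C[k+1]; k>n⇒nCk≡0; nCn≡1; nCk≡nC[n∸k]; nCk≡n!/k![n-k]!; k![n∸k]!∣n!)
import Data.Nat.Coprimality as Coprimality
open import Data.Nat.DivMod using (_/_; _%_; m≡m%n+[m/n]*n; m%n<n; m/n*n≡m)
open import Data.Nat.Divisibility using (_∣_; divides; quotient; m%n≡0⇒n∣m; *-cancelʳ-∣; *-cancelˡ-∣)
open import Data.Nat.GCD using (module Bézout)
open import Data.Nat.Primality using (Prime; prime⇒nonTrivial; prime⇒irreducible; ¬prime[0])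
import Data.Nat.Properties as ℕₚ
open import Data.Nat.Properties using (_!≢0; _!*_!≢0)
open import Data.Product using (Σ; ∃; ∃₂; _×_; _,_; proj₁; proj₂)
open import Data.Sum using (_⊎_; inj₁; inj₂; [_,_]′)
open import Function using (_∘_; id)
open import Relation.Binary.PropositionalEquality as ≡ using (_≡_; _≢_)
open import Relation.Nullary using (¬_; Dec; yes; no; contradiction)
open import Relation.Nullary.Decidable using (map′; ¬?)

-- Binomial coefficients and repunits in ℕ.

C[n,k]*k!*[n∸k]!≡n! : ∀ {n k} → k ≤ n → (n C k) *ℕ ((k !) *ℕ ((n ∸ k) !)) ≡ n !
C[n,k]*k!*[n∸k]!≡n! {n} {k} k≤n = ≡.trans
  (≡.cong (_*ℕ ((k !) *ℕ ((n ∸ k) !))) (nCk≡n!/k![n-k]! k≤n))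
  (m/n*n≡m {{k !* (n ∸ k) !≢0}} (k![n∸k]!∣n! k≤n))

nC0≡1 : ∀ n → n C 0 ≡ 1
nC0≡1 n = ≡.trans (nCk≡nC[n∸k] {0} {n} z≤n) (nCn≡1 n)

-- The number written with `n` ones in base `p`. Multiples of it describe numbers with constant
-- digits, and the recursion splits off the lowest digit as Lucas' theorem does.
repunit : ℕ → ℕ → ℕ
repunit p zero    = 0
repunit p (suc n) = suc (p *ℕ repunit p n)

repunit-suc : ∀ p n → repunit p (suc n) ≡ repunit p n +ℕ p ^ℕ n
repunit-suc p zero    = ≡.cong suc (ℕₚ.*-zeroʳ p)
repunit-suc p (suc n) = ≡.cong suc (≡.trans (≡.cong (p *ℕ_) (repunit-suc p n)) (ℕₚ.*-distribˡ-+ p _ _))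

*-repunit-suc : ∀ p e M → e *ℕ suc (p *ℕ M) ≡ e +ℕ (e *ℕ M) *ℕ p
*-repunit-suc p e M = ≡.trans (ℕₚ.*-suc e (p *ℕ M)) (≡.cong (e +ℕ_)
  (≡.trans (≡.cong (e *ℕ_) (ℕₚ.*-comm p M)) (≡.sym (ℕₚ.*-assoc e M p))))

^≡1+*repunit : ∀ d n → suc d ^ℕ n ≡ suc (d *ℕ repunit (suc d) n)
^≡1+*repunit d zero    = ≡.cong suc (≡.sym (ℕₚ.*-zeroʳ d))
^≡1+*repunit d (suc n) = begin
  suc d *ℕ suc d ^ℕ n                     ≡⟨ ≡.cong (suc d *ℕ_) (^≡1+*repunit d n) ⟩
  suc d *ℕ suc (d *ℕ M)                   ≡⟨ lemma d M ⟩
  suc (d *ℕ suc (suc d *ℕ M))             ∎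
  where
  open ≡.≡-Reasoning
  open import Data.Nat.Tactic.RingSolver renaming (solve-∀ to solveℕ)
  M = repunit (suc d) n
  lemma : ∀ d M → suc d *ℕ suc (d *ℕ M) ≡ suc (d *ℕ suc (suc d *ℕ M))
  lemma = solveℕ

-- Powers, finite sums and the image of ℕ in a commutative ring.

module CommutativeRingTools {c ℓ : Level} (F : CommutativeRing c ℓ) where
  open CommutativeRing F public hiding (zero)
  open import Algebra.Properties.Ring ring public using (-‿involutive; -0#≈0#; -‿distribˡ-*; -‿distribʳ-*; -‿+-comm; x∙y⁻¹≈ε⇒x≈y; +-cancelʳ; +-cancelˡ)
  open import Algebra.Properties.Semiring.Sum semiring public
    using (sum; sum-cong-≋; sum-replicate; sum-replicate-zero; ∑-distrib-+; ∑-comm; sum-permute; *-distribˡ-sum; *-distribʳ-sum)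
  open import Algebra.Properties.CommutativeSemiring.Exp commutativeSemiring public
    using (_^_; ^-congˡ; ^-congʳ; ^-homo-*; ^-assocʳ; ^-distrib-*)
  open import Algebra.Properties.Semiring.Mult semiring public
    using (×-congˡ; ×-congʳ; ×-homo-+; ×-assoc-*; ×1-homo-*) renaming (_×_ to _⋆_)
  open import Relation.Binary.Reasoning.Setoid setoid public

  open import Algebra.Solver.Ring.NaturalCoefficients.Default commutativeSemiring public
    using (solve; _:+_; _:*_; _:=_)

  [x-y]+y≈x : ∀ x y → (x - y) + y ≈ x
  [x-y]+y≈x x y = trans (+-assoc x (- y) y) (trans (+-congˡ (-‿inverseˡ y)) (+-identityʳ x))

  [x+y]-y≈x : ∀ x y → (x + y) - y ≈ x
  [x+y]-y≈x x y = trans (+-assoc x y (- y)) (trans (+-congˡ (-‿inverseʳ y)) (+-identityʳ x))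

  pow≡^ : ∀ x n → pow F x n ≡ x ^ n
  pow≡^ x zero    = ≡.refl
  pow≡^ x (suc n) = ≡.cong (x *_) (pow≡^ x n)

  open import Algebra.Properties.CommutativeSemiring.Binomial commutativeSemiring public
    using () renaming (theorem to binomial-theorem)

  1^n≈1 : ∀ n → 1# ^ n ≈ 1#
  1^n≈1 zero    = refl
  1^n≈1 (suc n) = trans (*-identityˡ _) (1^n≈1 n)

  ^-swap : ∀ x m n → (x ^ m) ^ n ≈ (x ^ n) ^ m
  ^-swap x m n = trans (^-assocʳ x m n) (trans (^-congʳ x (ℕₚ.*-comm m n)) (sym (^-assocʳ x n m)))

  sum-zero : ∀ {n} (t : Fin n → Carrier) → (∀ i → t i ≈ 0#) → sum t ≈ 0#
  sum-zero {n} t t≈0 = trans (sum-cong-≋ t≈0) (sum-replicate-zero n)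

  sum-single : ∀ {n} (t : Fin n → Carrier) i → (∀ j → j ≢ i → t j ≈ 0#) → sum t ≈ t i
  sum-single t zero    off = trans (+-congˡ (sum-zero _ (λ j → off (suc j) λ ()))) (+-identityʳ _)
  sum-single t (suc i) off = trans (+-congʳ (off zero λ ()))
    (trans (+-identityˡ _) (sum-single (t ∘ suc) i (λ j j≢i → off (suc j) (j≢i ∘ Finₚ.suc-injective))))

  ι : ℕ → Carrier
  ι n = n ⋆ 1#

  ι-cong : ∀ {m n} → m ≡ n → ι m ≈ ι n
  ι-cong = ×-congˡ

  ι-1 : ι 1 ≈ 1#
  ι-1 = +-identityʳ 1#

  ι-+ : ∀ m n → ι (m +ℕ n) ≈ ι m + ι n
  ι-+ = ×-homo-+ 1#

  ι-* : ∀ m n → ι (m *ℕ n) ≈ ι m * ι n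
  ι-* = ×1-homo-*

  ι-^ : ∀ m n → ι (m ^ℕ n) ≈ ι m ^ n
  ι-^ m zero    = ι-1
  ι-^ m (suc n) = trans (ι-* m (m ^ℕ n)) (*-congˡ (ι-^ m n))

  ⋆≈ι* : ∀ n x → n ⋆ x ≈ ι n * x
  ⋆≈ι* n x = sym (trans (×-assoc-* n 1# x) (×-congʳ n (*-identityˡ x)))

-- Finite fields: decidable equality, cancellation and sums over all elements.

module FiniteField {c ℓ : Level} (F : CommutativeRing c ℓ) (isField : IsField F)
                   {q : ℕ} (size : HasSize F q) where
  open CommutativeRingTools F public

  private
    to      = proj₁ size
    from    = proj₁ (proj₂ size)
    to-cong = proj₁ (proj₂ (proj₂ size))
    from∘to = proj₁ (proj₂ (proj₂ (proj₂ size)))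
    to∘from = proj₂ (proj₂ (proj₂ (proj₂ size)))

  1≉0 : ¬ 1# ≈ 0#
  1≉0 = proj₁ isField

  to-injective : ∀ {x y} → to x ≡ to y → x ≈ y
  to-injective {x} {y} eq = trans (sym (from∘to x)) (trans (reflexive (≡.cong from eq)) (from∘to y))

  infix 4 _≟_
  _≟_ : ∀ x y → Dec (x ≈ y)
  x ≟ y = map′ to-injective (to-cong x y) (to x Finₚ.≟ to y)

  *-cancelˡ-≉0 : ∀ {x y z} → ¬ x ≈ 0# → x * y ≈ x * z → y ≈ z
  *-cancelˡ-≉0 {x} {y} {z} x≉0 eq with x⁻¹ , inv ← proj₂ isField x x≉0 = begin
    y              ≈⟨ *-identityˡ y ⟨
    1# * y         ≈⟨ *-congʳ inv ⟨
    (x * x⁻¹) * y  ≈⟨ solve 3 (λ x i y → (x :* i) :* y := i :* (x :* y)) refl x x⁻¹ y ⟩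
    x⁻¹ * (x * y)  ≈⟨ *-congˡ eq ⟩
    x⁻¹ * (x * z)  ≈⟨ solve 3 (λ x i y → (x :* i) :* y := i :* (x :* y)) refl x x⁻¹ z ⟨
    (x * x⁻¹) * z  ≈⟨ *-congʳ inv ⟩
    1# * z         ≈⟨ *-identityˡ z ⟩
    z              ∎
  *-≉0 : ∀ {x y} → ¬ x ≈ 0# → ¬ y ≈ 0# → ¬ x * y ≈ 0#
  *-≉0 {x} x≉0 y≉0 xy≈0 = y≉0 (*-cancelˡ-≉0 x≉0 (trans xy≈0 (sym (zeroʳ x))))

  ^-≉0 : ∀ {x} → ¬ x ≈ 0# → ∀ n → ¬ x ^ n ≈ 0#
  ^-≉0 x≉0 zero    = 1≉0
  ^-≉0 x≉0 (suc n) = *-≉0 x≉0 (^-≉0 x≉0 n)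

  *-≉0ˡ : ∀ {x y} → ¬ x * y ≈ 0# → ¬ x ≈ 0#
  *-≉0ˡ {x} {y} xy≉0 x≈0 = xy≉0 (trans (*-congʳ x≈0) (zeroˡ y))

  *-≉0ʳ : ∀ {x y} → ¬ x * y ≈ 0# → ¬ y ≈ 0#
  *-≉0ʳ {x} {y} xy≉0 y≈0 = xy≉0 (trans (*-congˡ y≈0) (zeroʳ x))

  -‿≉0 : ∀ {x} → ¬ x ≈ 0# → ¬ - x ≈ 0#
  -‿≉0 {x} x≉0 -x≈0 = x≉0 (trans (sym (-‿involutive x)) (trans (-‿cong -x≈0) -0#≈0#))

  -- Opaque, so that later goals mention `∑F` and not the enumeration supplied by `HasSize`.
  opaque
    ∑F : (Carrier → Carrier) → Carrier
    ∑F g = sum (λ i → g (from i))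

    ∑F-cong : ∀ {g h} → (∀ x → g x ≈ h x) → ∑F g ≈ ∑F h
    ∑F-cong g≈h = sum-cong-≋ (λ i → g≈h (from i))

    ∑F-zero : ∀ {g} → (∀ x → g x ≈ 0#) → ∑F g ≈ 0#
    ∑F-zero {g} g≈0 = sum-zero (g ∘ from) (λ i → g≈0 (from i))

    ∑F-+ : ∀ g h → ∑F (λ x → g x + h x) ≈ ∑F g + ∑F h
    ∑F-+ g h = ∑-distrib-+ (g ∘ from) (h ∘ from)

    ∑F-*ˡ : ∀ a g → ∑F (λ x → a * g x) ≈ a * ∑F g
    ∑F-*ˡ a g = sym (*-distribˡ-sum a (g ∘ from))

    ∑F-reindex : ∀ {π ρ g} → Congruent F π → Congruent F ρ → (∀ x → π (ρ x) ≈ x) → (∀ x → ρ (π x) ≈ x) →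
                 Congruent F g → ∑F g ≈ ∑F (λ x → g (π x))
    ∑F-reindex {π} {ρ} {g} π-cong ρ-cong π∘ρ ρ∘π g-cong = begin
      ∑F g                                  ≈⟨ sum-permute (g ∘ from) perm ⟩
      sum (λ i → g (from (perm ⟨$⟩ʳ i)))    ≈⟨ sum-cong-≋ (λ i → g-cong _ _ (from∘to (π (from i)))) ⟩
      ∑F (λ x → g (π x))                    ∎
      where
      perm : Permutation q q
      perm = permutation (to ∘ π ∘ from) (to ∘ ρ ∘ from)
        (λ i → ≡.trans (to-cong _ _ (trans (π-cong _ _ (from∘to _)) (π∘ρ _))) (to∘from i))
        (λ i → ≡.trans (to-cong _ _ (trans (ρ-cong _ _ (from∘to _)) (ρ∘π _))) (to∘from i))

    ∑F-single : ∀ g a → Congruent F g → (∀ x → ¬ x ≈ a → g x ≈ 0#) → ∑F g ≈ g a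
    ∑F-single g a g-cong off = trans
      (sum-single (g ∘ from) (to a) (λ j j≢ → off (from j) (λ eq → j≢ (≡.trans (≡.sym (to∘from j)) (to-cong _ _ eq)))))
      (g-cong _ _ (from∘to a))

    -- Finiteness and decidable equality make the witness explicit; walks obtain their intermediate
    -- vertices from it.
    ∑F≉0⇒∃≉0 : ∀ g → ¬ ∑F g ≈ 0# → ∃ λ x → ¬ g x ≈ 0#
    ∑F≉0⇒∃≉0 g ∑≉0 with Finₚ.any? (λ i → ¬? (g (from i) ≟ 0#))
    ... | yes (i , gi≉0) = from i , gi≉0
    ... | no none = ⊥-elim (∑≉0 (sum-zero (g ∘ from) vanish))
      where
      vanish : ∀ i → g (from i) ≈ 0#
      vanish i with g (from i) ≟ 0#
      ... | yes gi≈0 = gi≈0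
      ... | no gi≉0 = ⊥-elim (none (i , gi≉0))

    ∑F-sum : ∀ {n} (g : Fin n → Carrier → Carrier) → ∑F (λ x → sum (λ i → g i x)) ≈ sum (λ i → ∑F (g i))
    ∑F-sum g = ∑-comm (λ i j → g j (from i))

    ∑F-1 : ∑F (λ _ → 1#) ≈ ι q
    ∑F-1 = sum-replicate q

  -- The shift x ↦ x + 1 permutes F, so the sum of all elements does not change when `ι q` is added
  -- to it.
  ι-size≈0 : ι q ≈ 0#
  ι-size≈0 = +-cancelˡ (∑F (λ x → x)) _ _ (begin
    ∑F (λ x → x) + ι q             ≈⟨ +-congˡ ∑F-1 ⟨
    ∑F (λ x → x) + ∑F (λ _ → 1#)   ≈⟨ ∑F-+ _ _ ⟨
    ∑F (λ x → x + 1#)              ≈⟨ ∑F-reindex {π = λ x → x + 1#} {ρ = λ x → x - 1#} {g = λ x → x}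
                                        (λ _ _ → +-congʳ) (λ _ _ → +-congʳ)
                                        (λ x → [x-y]+y≈x x 1#) (λ x → [x+y]-y≈x x 1#) (λ _ _ eq → eq) ⟨
    ∑F (λ x → x)                   ≈⟨ +-identityʳ _ ⟨
    ∑F (λ x → x) + 0#              ∎)

  size≤ : ∀ {n} (idx : Carrier → Fin n) (decode : Fin n → Carrier) → (∀ x → decode (idx x) ≈ x) → q ≤ n
  size≤ idx decode inv = Finₚ.injective⇒≤ {f = idx ∘ from} λ {i} {j} eq →
    ≡.trans (≡.sym (to∘from i)) (≡.trans
      (to-cong _ _ (trans (sym (inv _)) (trans (reflexive (≡.cong decode eq)) (inv _))))
      (to∘from j))

  -- Only q - 1 values are available: `punchOut` deletes the index of 0, so `q` nonzero values
  -- already collide.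
  nonzero-pigeonhole : ∀ {n} → q ≤ n → (g : Fin n → Carrier) → (∀ i → ¬ g i ≈ 0#) →
                       ∃₂ λ i j → (i Fin.< j) × (g i ≈ g j)
  nonzero-pigeonhole q≤n g g≉0 = go to to-injective q≤n
    where
    -- `q` is a parameter of the module; it is generalised here so that it can be split into zero
    -- and successor.
    go : ∀ {q} (to : Carrier → Fin q) → (∀ {x y} → to x ≡ to y → x ≈ y) → q ≤ _ →
         ∃₂ λ i j → (i Fin.< j) × (g i ≈ g j)
    go {zero}  to _ _ = contradiction (to 0#) Finₚ.¬Fin0
    go {suc Q} to to-inj Q<n =
      let i , j , i<j , eq = Finₚ.pigeonhole Q<n (λ i → punchOut (λ e → g≉0 i (sym (to-inj e))))
      in i , j , i<j , to-inj (Finₚ.punchOut-injective (λ e → g≉0 i (sym (to-inj e))) (λ e → g≉0 j (sym (to-inj e))) eq)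

-- Characteristic `p`: binomial coefficients in F, Lucas' theorem and Frobenius.

module PrimePowerOrder {c ℓ : Level} (F : CommutativeRing c ℓ) (isField : IsField F)
                  {d R : ℕ} (p-prime : Prime (suc d)) (size : HasSize F (suc d ^ℕ R)) where
  open FiniteField F isField size public

  p : ℕ
  p = suc d

  -- The power `ι p ^ R` equals `ι q`, which is 0, and a field has no nilpotent elements except 0.
  ι-p≈0 : ι p ≈ 0#
  ι-p≈0 with ι p ≟ 0#
  ... | yes eq = eq
  ... | no neq = ⊥-elim (^-≉0 neq R (trans (sym (ι-^ p R)) ι-size≈0))

  ι-multiple≈0 : ∀ n → ι (n *ℕ p) ≈ 0#
  ι-multiple≈0 n = trans (ι-* n p) (trans (*-congˡ ι-p≈0) (zeroʳ _))

  -- A Bézout relation between `n` and `p` would turn `ι n ≈ 0#` into 1 = 0, since multiples of `p`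
  -- vanish in F.
  ι-≉0 : ∀ {n} → 0 < n → n < p → ¬ ι n ≈ 0#
  ι-≉0 {n@(suc _)} _ n<p ιn≈0 with Coprimality.coprime-Bézout (Coprimality.sym (Coprimality.prime⇒coprime p-prime n<p))
  ... | Bézout.+- x y eq = 1≉0 (begin
    1#                    ≈⟨ +-identityʳ 1# ⟨
    1# + 0#               ≈⟨ +-congˡ (ι-multiple≈0 y) ⟨
    ι (1 +ℕ y *ℕ p)       ≈⟨ ι-cong eq ⟩
    ι (x *ℕ n)            ≈⟨ ι-* x n ⟩
    ι x * ι n             ≈⟨ *-congˡ ιn≈0 ⟩
    ι x * 0#              ≈⟨ zeroʳ _ ⟩
    0#                    ∎)
  ... | Bézout.-+ x y eq = 1≉0 (begin
    1#                    ≈⟨ +-identityʳ 1# ⟨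
    1# + 0#               ≈⟨ +-congˡ (trans (ι-* x n) (trans (*-congˡ ιn≈0) (zeroʳ _))) ⟨
    ι (1 +ℕ x *ℕ n)       ≈⟨ ι-cong eq ⟩
    ι (y *ℕ p)            ≈⟨ ι-multiple≈0 y ⟩
    0#                    ∎)

  ι-!≉0 : ∀ {n} → n < p → ¬ ι (n !) ≈ 0#
  ι-!≉0 {zero}  _   eq = 1≉0 (trans (sym ι-1) eq)
  ι-!≉0 {suc n} n<p eq = *-≉0 (ι-≉0 (s≤s z≤n) n<p) (ι-!≉0 {n} (ℕₚ.<-trans (ℕₚ.n<1+n n) n<p))
    (trans (sym (ι-* (suc n) (n !))) eq)

  bin : ℕ → ℕ → Carrier
  bin n k = ι (n C k)

  bin-pascal : ∀ n k → bin (suc n) (suc k) ≈ bin n k + bin n (suc k)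
  bin-pascal n k = trans (ι-cong (≡.sym (nCk+nC[k+1]≡[n+1]C[k+1] n k))) (ι-+ (n C k) (n C suc k))

  bin-> : ∀ {n k} → n < k → bin n k ≈ 0#
  bin-> n<k = ι-cong (k>n⇒nCk≡0 n<k)

  bin-0 : ∀ n → bin n 0 ≈ 1#
  bin-0 n = trans (ι-cong (nC0≡1 n)) ι-1

  bin-refl : ∀ n → bin n n ≈ 1#
  bin-refl n = trans (ι-cong (nCn≡1 n)) ι-1

  bin-! : ∀ {n k} → k ≤ n → bin n k * ι ((k !) *ℕ ((n ∸ k) !)) ≈ ι (n !)
  bin-! {n} {k} k≤n = trans (sym (ι-* (n C k) _)) (ι-cong (C[n,k]*k!*[n∸k]!≡n! k≤n))

  bin-digit≉0 : ∀ {n k} → k ≤ n → n < p → ¬ bin n k ≈ 0#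
  bin-digit≉0 {n} {k} k≤n n<p = *-≉0ˡ λ eq → ι-!≉0 n<p (trans (sym (bin-! k≤n)) eq)

  -- In C(p, k) k! (p - k)! = p! the right side vanishes in F while both factorials on the left do
  -- not.
  bin-p≈0 : ∀ {k} → 0 < k → k < p → bin p k ≈ 0#
  bin-p≈0 {k} 0<k k<p with bin p k ≟ 0#
  ... | yes eq = eq
  ... | no neq = ⊥-elim (*-≉0 neq
    (λ eq → *-≉0 (ι-!≉0 k<p) (ι-!≉0 (ℕₚ.∸-monoʳ-< 0<k (ℕₚ.<⇒≤ k<p))) (trans (sym (ι-* (k !) _)) eq))
    (trans (bin-! (ℕₚ.<⇒≤ k<p)) ι-p!≈0))
    where
    ι-p!≈0 : ι (p !) ≈ 0#
    ι-p!≈0 = trans (ι-* p (d !)) (trans (*-congʳ ι-p≈0) (zeroˡ _))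

  -- This and `bin-+p-high` compare coefficients in (1 + x)^(n + p) = (1 + x)^n (1 + x^p), proved
  -- through Pascal's rule instead of generating functions.
  bin-+p-low : ∀ n {k} → k < p → bin (n +ℕ p) k ≈ bin n k
  bin-+p-low n       {zero}  _   = trans (bin-0 (n +ℕ p)) (sym (bin-0 n))
  bin-+p-low zero    {suc k} k<p = trans (bin-p≈0 (s≤s z≤n) k<p) (sym (bin-> {0} {suc k} (s≤s z≤n)))
  bin-+p-low (suc n) {suc k} k<p = begin
    bin (suc n +ℕ p) (suc k)              ≈⟨ bin-pascal (n +ℕ p) k ⟩
    bin (n +ℕ p) k + bin (n +ℕ p) (suc k) ≈⟨ +-cong (bin-+p-low n (ℕₚ.<-trans (ℕₚ.n<1+n k) k<p)) (bin-+p-low n k<p) ⟩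
    bin n k + bin n (suc k)               ≈⟨ bin-pascal n k ⟨
    bin (suc n) (suc k)                   ∎

  bin-+p-high : ∀ n k → bin (n +ℕ p) (k +ℕ p) ≈ bin n (k +ℕ p) + bin n k
  bin-+p-high zero    zero    = begin
    bin p p                ≈⟨ bin-refl p ⟩
    1#                     ≈⟨ +-identityˡ 1# ⟨
    0# + 1#                ≈⟨ +-cong (bin-> {0} {p} (s≤s z≤n)) (bin-0 0) ⟨
    bin 0 p + bin 0 0      ∎
  bin-+p-high zero    (suc k) = begin
    bin p (suc k +ℕ p)                   ≈⟨ bin-> (s≤s (ℕₚ.m≤n+m p k)) ⟩
    0#                                   ≈⟨ +-identityˡ 0# ⟨
    0# + 0#                              ≈⟨ +-cong (bin-> {0} {suc k +ℕ p} (s≤s z≤n)) (bin-> {0} {suc k} (s≤s z≤n)) ⟨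
    bin 0 (suc k +ℕ p) + bin 0 (suc k)   ∎
  bin-+p-high (suc n) zero    = begin
    bin (suc n +ℕ p) p                         ≈⟨ bin-pascal (n +ℕ p) d ⟩
    bin (n +ℕ p) d + bin (n +ℕ p) p            ≈⟨ +-cong (bin-+p-low n (ℕₚ.n<1+n d)) (bin-+p-high n zero) ⟩
    bin n d + (bin n p + bin n 0)              ≈⟨ +-assoc _ _ _ ⟨
    (bin n d + bin n p) + bin n 0              ≈⟨ +-cong (sym (bin-pascal n d)) (trans (bin-0 n) (sym (bin-0 (suc n)))) ⟩
    bin (suc n) p + bin (suc n) 0              ∎
  bin-+p-high (suc n) (suc k) = begin
    bin (suc n +ℕ p) (suc k +ℕ p)
      ≈⟨ bin-pascal (n +ℕ p) (k +ℕ p) ⟩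
    bin (n +ℕ p) (k +ℕ p) + bin (n +ℕ p) (suc k +ℕ p)
      ≈⟨ +-cong (bin-+p-high n k) (bin-+p-high n (suc k)) ⟩
    (bin n (k +ℕ p) + bin n k) + (bin n (suc k +ℕ p) + bin n (suc k))
      ≈⟨ solve 4 (λ a b c d → (a :+ b) :+ (c :+ d) := (a :+ c) :+ (b :+ d)) refl _ _ _ _ ⟩
    (bin n (k +ℕ p) + bin n (suc k +ℕ p)) + (bin n k + bin n (suc k))
      ≈⟨ +-cong (bin-pascal n (k +ℕ p)) (bin-pascal n k) ⟨
    bin (suc n) (suc k +ℕ p) + bin (suc n) (suc k) ∎

  private
    x+[p+y]≡x+y+p : ∀ x y → x +ℕ (p +ℕ y) ≡ (x +ℕ y) +ℕ p
    x+[p+y]≡x+y+p x y = ≡.trans (≡.cong (x +ℕ_) (ℕₚ.+-comm p y)) (≡.sym (ℕₚ.+-assoc x y p))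

  -- One digit of Lucas' theorem, `b` and `e` being the lowest digits. The recursion removes one `p`
  -- from the upper entry at a time; if the lower entry also contains a `p`, two terms arise and
  -- Pascal's rule for `a` and `c` joins them.
  lucas : ∀ a c {b e} → b < p → e < p → bin (b +ℕ a *ℕ p) (e +ℕ c *ℕ p) ≈ bin a c * bin b e
  lucas zero zero {b} {e} b<p e<p = begin
    bin (b +ℕ 0) (e +ℕ 0)   ≈⟨ ι-cong (≡.cong₂ _C_ (ℕₚ.+-identityʳ b) (ℕₚ.+-identityʳ e)) ⟩
    bin b e                 ≈⟨ *-identityˡ _ ⟨
    1# * bin b e            ≈⟨ *-congʳ (bin-0 0) ⟨
    bin 0 0 * bin b e       ∎
  lucas zero (suc c) {b} {e} b<p e<p = begin
    bin (b +ℕ 0) (e +ℕ suc c *ℕ p)   ≈⟨ bin-> (≡.subst (_< _) (≡.sym (ℕₚ.+-identityʳ b))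
                                          (ℕₚ.<-≤-trans b<p (ℕₚ.≤-trans (ℕₚ.m≤m+n p (c *ℕ p)) (ℕₚ.m≤n+m _ e)))) ⟩
    0#                               ≈⟨ zeroˡ _ ⟨
    0# * bin b e                     ≈⟨ *-congʳ (bin-> {0} {suc c} (s≤s z≤n)) ⟨
    bin 0 (suc c) * bin b e          ∎
  lucas (suc a) zero {b} {e} b<p e<p = begin
    bin (b +ℕ suc a *ℕ p) (e +ℕ 0)       ≈⟨ ι-cong (≡.cong₂ _C_ (x+[p+y]≡x+y+p b (a *ℕ p)) (ℕₚ.+-identityʳ e)) ⟩
    bin ((b +ℕ a *ℕ p) +ℕ p) e           ≈⟨ bin-+p-low (b +ℕ a *ℕ p) e<p ⟩
    bin (b +ℕ a *ℕ p) e                  ≈⟨ ι-cong (≡.cong ((b +ℕ a *ℕ p) C_) (ℕₚ.+-identityʳ e)) ⟨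
    bin (b +ℕ a *ℕ p) (e +ℕ 0)           ≈⟨ lucas a zero b<p e<p ⟩
    bin a 0 * bin b e                    ≈⟨ *-congʳ (trans (bin-0 a) (sym (bin-0 (suc a)))) ⟩
    bin (suc a) 0 * bin b e              ∎
  lucas (suc a) (suc c) {b} {e} b<p e<p = begin
    bin (b +ℕ suc a *ℕ p) (e +ℕ suc c *ℕ p)
      ≈⟨ ι-cong (≡.cong₂ _C_ (x+[p+y]≡x+y+p b (a *ℕ p)) (x+[p+y]≡x+y+p e (c *ℕ p))) ⟩
    bin (A +ℕ p) ((e +ℕ c *ℕ p) +ℕ p)
      ≈⟨ bin-+p-high A (e +ℕ c *ℕ p) ⟩
    bin A ((e +ℕ c *ℕ p) +ℕ p) + bin A (e +ℕ c *ℕ p)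
      ≈⟨ +-congʳ (ι-cong (≡.cong (A C_) (x+[p+y]≡x+y+p e (c *ℕ p)))) ⟨
    bin A (e +ℕ suc c *ℕ p) + bin A (e +ℕ c *ℕ p)
      ≈⟨ +-cong (lucas a (suc c) b<p e<p) (lucas a c b<p e<p) ⟩
    bin a (suc c) * bin b e + bin a c * bin b e
      ≈⟨ solve 3 (λ x y z → x :* z :+ y :* z := (y :+ x) :* z) refl _ _ _ ⟩
    (bin a c + bin a (suc c)) * bin b e
      ≈⟨ *-congʳ (bin-pascal a c) ⟨
    bin (suc a) (suc c) * bin b e ∎
    where
    A = b +ℕ a *ℕ p

  binomial : ∀ n x y → (x + y) ^ n ≈ sum {suc n} (λ i → bin n (toℕ i) * (x ^ toℕ i * y ^ (n ∸ toℕ i)))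
  binomial n x y = trans (binomial-theorem n x y) (sum-cong-≋ {suc n} (λ i → ⋆≈ι* (n C toℕ i) (x ^ toℕ i * y ^ (n ∸ toℕ i))))

  0^n≈0 : ∀ {x n} → 0 < n → x ≈ 0# → x ^ n ≈ 0#
  0^n≈0 {n = suc n} _ x≈0 = trans (*-congʳ x≈0) (zeroˡ _)

  frobenius-+ : ∀ x y → (x + y) ^ p ≈ x ^ p + y ^ p
  frobenius-+ x y = begin
    (x + y) ^ p                       ≈⟨ binomial p x y ⟩
    t zero + sum (t ∘ suc)            ≈⟨ +-cong t₀ (sum-single (t ∘ suc) (Fin.fromℕ d) middle) ⟩
    y ^ p + t (suc (Fin.fromℕ d))     ≈⟨ +-congˡ tₚ ⟩
    y ^ p + x ^ p                     ≈⟨ +-comm _ _ ⟩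
    x ^ p + y ^ p                     ∎
    where
    t : Fin (suc p) → Carrier
    t i = bin p (toℕ i) * (x ^ toℕ i * y ^ (p ∸ toℕ i))
    t₀ : t zero ≈ y ^ p
    t₀ = trans (*-cong (bin-0 p) (*-identityˡ _)) (*-identityˡ _)
    tₚ : t (suc (Fin.fromℕ d)) ≈ x ^ p
    tₚ = begin
      bin p (suc j) * (x ^ suc j * y ^ (d ∸ j))  ≈⟨ reflexive (≡.cong (λ j → bin p (suc j) * (x ^ suc j * y ^ (d ∸ j))) (Finₚ.toℕ-fromℕ d)) ⟩
      bin p p * (x ^ p * y ^ (d ∸ d))            ≈⟨ *-cong (bin-refl p) (*-congˡ (^-congʳ y (ℕₚ.n∸n≡0 d))) ⟩
      1# * (x ^ p * 1#)                          ≈⟨ trans (*-identityˡ _) (*-identityʳ _) ⟩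
      x ^ p                                      ∎
      where j = toℕ (Fin.fromℕ d)
    middle : ∀ j → j ≢ Fin.fromℕ d → t (suc j) ≈ 0#
    middle j j≢d = trans (*-congʳ (bin-p≈0 (s≤s z≤n) (s≤s (ℕₚ.≤∧≢⇒< (ℕ.s≤s⁻¹ (Finₚ.toℕ<n j))
      (λ eq → j≢d (Finₚ.toℕ-injective (≡.trans eq (≡.sym (Finₚ.toℕ-fromℕ d))))))))) (zeroˡ _)

  frobenius-- : ∀ x y → (x - y) ^ p ≈ x ^ p - y ^ p
  frobenius-- x y = begin
    (x - y) ^ p                     ≈⟨ [x+y]-y≈x _ (y ^ p) ⟨
    ((x - y) ^ p + y ^ p) - y ^ p   ≈⟨ +-congʳ (frobenius-+ (x - y) y) ⟨
    ((x - y) + y) ^ p - y ^ p       ≈⟨ +-congʳ (^-congˡ p ([x-y]+y≈x x y)) ⟩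
    x ^ p - y ^ p                   ∎

-- The order of ω, Fermat's theorem and power sums over F.

module PrimitiveElement {c ℓ : Level} (F : CommutativeRing c ℓ) (isField : IsField F)
                        {d R : ℕ} (p-prime : Prime (suc d)) (size : HasSize F (suc d ^ℕ R))
                        (2<p : 2 < suc d) (ω : CommutativeRing.Carrier F) (generates : IsPrimitive F ω) where
  open PrimePowerOrder F isField {d} {R} p-prime size public

  opaque
    Q : ℕ
    Q = d *ℕ repunit p R

    Q≡d*repunit : Q ≡ d *ℕ repunit p R
    Q≡d*repunit = ≡.refl

    q≡1+Q : p ^ℕ R ≡ suc Q
    q≡1+Q = ^≡1+*repunit d R

  log : ∀ x → ¬ x ≈ 0# → ∃ λ j → x ≈ ω ^ j
  log x x≉0 with j , eq ← generates x x≉0 = j , trans eq (reflexive (pow≡^ ω j))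

  -- `IsPrimitive` alone allows ω = 0 in the field with two elements, because 0^0 = 1. For p > 2 the
  -- element 2 is neither 0 nor 1, hence not a power of 0.
  ω≉0 : ¬ ω ≈ 0#
  ω≉0 ω≈0 with log (ι 2) (ι-≉0 (s≤s z≤n) 2<p)
  ... | zero  , eq = 1≉0 (+-cancelˡ 1# _ _ (trans (+-congˡ (sym ι-1)) (trans eq (sym (+-identityʳ 1#)))))
  ... | suc j , eq = ι-≉0 (s≤s z≤n) 2<p (trans eq (trans (*-congʳ ω≈0) (zeroˡ _)))

  ^-periodic : ∀ {b} .{{_ : NonZero b}} → ω ^ b ≈ 1# → ∀ j → ω ^ j ≈ ω ^ (j % b)
  ^-periodic {b} ω^b≈1 j = begin
    ω ^ j                             ≈⟨ ^-congʳ ω (m≡m%n+[m/n]*n j b) ⟩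
    ω ^ (j % b +ℕ (j / b) *ℕ b)       ≈⟨ ^-homo-* ω (j % b) _ ⟩
    ω ^ (j % b) * ω ^ ((j / b) *ℕ b)  ≈⟨ *-congˡ (trans (sym (^-assocʳ ω (j / b) b)) (^-swap ω (j / b) b)) ⟩
    ω ^ (j % b) * (ω ^ b) ^ (j / b)   ≈⟨ *-congˡ (trans (^-congˡ (j / b) ω^b≈1) (1^n≈1 (j / b))) ⟩
    ω ^ (j % b) * 1#                  ≈⟨ *-identityʳ _ ⟩
    ω ^ (j % b)                       ∎

  -- Exponents of ω matter only modulo `b`, so F consists of 0 and at most `b` powers of ω, whence q
  -- ≤ b + 1.
  ω-order-minimal : ∀ {b} → 0 < b → ω ^ b ≈ 1# → Q ≤ b
  ω-order-minimal {b@(suc _)} _ ω^b≈1 = ℕ.s≤s⁻¹ (≡.subst (_≤ suc b) q≡1+Q (size≤ idx decode decode∘idx))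
    where
    idx : Carrier → Fin (suc b)
    idx x with x ≟ 0#
    ... | yes _   = zero
    ... | no x≉0 = suc (fromℕ< (m%n<n (proj₁ (log x x≉0)) b))
    decode : Fin (suc b) → Carrier
    decode zero    = 0#
    decode (suc i) = ω ^ toℕ i
    decode∘idx : ∀ x → decode (idx x) ≈ x
    decode∘idx x with x ≟ 0#
    ... | yes x≈0 = sym x≈0
    ... | no x≉0 = begin
      ω ^ toℕ (fromℕ< (m%n<n j b))  ≈⟨ ^-congʳ ω (Finₚ.toℕ-fromℕ< (m%n<n j b)) ⟩
      ω ^ (j % b)                   ≈⟨ ^-periodic ω^b≈1 j ⟨
      ω ^ j                         ≈⟨ proj₂ (log x x≉0) ⟨
      x                             ∎
      where j = proj₁ (log x x≉0)

  -- Two of the powers with exponents 0, ..., q - 1 coincide. The difference of their exponents is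
  -- at most `Q`, and minimality makes it equal to `Q`.
  ω-order : (0 < Q) × (ω ^ Q ≈ 1#)
  ω-order with i , j , i<j , eq ← nonzero-pigeonhole {p ^ℕ R} ℕₚ.≤-refl (λ i → ω ^ toℕ i) (λ i → ^-≉0 ω≉0 (toℕ i)) =
    ≡.subst (0 <_) b≡Q 0<b , trans (^-congʳ ω (≡.sym b≡Q)) ω^b≈1
    where
    b = toℕ j ∸ toℕ i
    0<b : 0 < b
    0<b = ℕₚ.m<n⇒0<n∸m i<j
    ω^b≈1 : ω ^ b ≈ 1#
    ω^b≈1 = *-cancelˡ-≉0 (^-≉0 ω≉0 (toℕ i)) (begin
      ω ^ toℕ i * ω ^ b     ≈⟨ ^-homo-* ω (toℕ i) b ⟨
      ω ^ (toℕ i +ℕ b)      ≈⟨ ^-congʳ ω (ℕₚ.m+[n∸m]≡n (ℕₚ.<⇒≤ i<j)) ⟩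
      ω ^ toℕ j             ≈⟨ eq ⟨
      ω ^ toℕ i             ≈⟨ *-identityʳ _ ⟨
      ω ^ toℕ i * 1#        ∎)
    b≡Q : b ≡ Q
    b≡Q = ℕₚ.≤-antisym
      (ℕₚ.≤-trans (ℕₚ.m∸n≤m (toℕ j) (toℕ i)) (ℕ.s≤s⁻¹ (≡.subst (toℕ j <_) q≡1+Q (Finₚ.toℕ<n j))))
      (ω-order-minimal 0<b ω^b≈1)

  0<Q : 0 < Q
  0<Q = proj₁ ω-order

  ω^Q≈1 : ω ^ Q ≈ 1#
  ω^Q≈1 = proj₂ ω-order

  fermat : ∀ {x} → ¬ x ≈ 0# → x ^ Q ≈ 1#
  fermat {x} x≉0 with j , x≈ω^j ← log x x≉0 = begin
    x ^ Q        ≈⟨ ^-congˡ Q x≈ω^j ⟩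
    (ω ^ j) ^ Q  ≈⟨ ^-swap ω j Q ⟩
    (ω ^ Q) ^ j  ≈⟨ trans (^-congˡ j ω^Q≈1) (1^n≈1 j) ⟩
    1#           ∎

  fermat′ : ∀ x → x ^ (p ^ℕ R) ≈ x
  fermat′ x = trans (^-congʳ x q≡1+Q) (go (x ≟ 0#))
    where
    go : Dec (x ≈ 0#) → x * x ^ Q ≈ x
    go (yes x≈0) = trans (*-congʳ x≈0) (trans (zeroˡ _) (sym x≈0))
    go (no x≉0)  = trans (*-congˡ (fermat x≉0)) (*-identityʳ x)

  -- The substitution x ↦ ω x multiplies the sum by ω^b, so a nonzero sum forces ω^b = 1 and b ≥ Q.
  -- If b ≠ Q, then ω^(b - Q) = 1 as well, which gives b ≥ 2Q.
  ∑F-^≈0 : ∀ {b} → b < Q +ℕ Q → b ≢ Q → ∑F (_^ b) ≈ 0#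
  -- Here x^0 is 1 also at x = 0, so the sum counts all `q` elements.
  ∑F-^≈0 {zero}      _    _   = trans ∑F-1 ι-size≈0
  ∑F-^≈0 {b@(suc _)} b<2Q b≢Q with ∑F (_^ b) ≟ 0#
  ... | yes eq = eq
  ... | no neq with ω⁻¹ , inv ← proj₂ isField ω ω≉0 = ⊥-elim (b-excluded (ω-order-minimal (s≤s z≤n) ω^b≈1))
    where
    cancel : ∀ {u v} → u * v ≈ 1# → ∀ x → u * (v * x) ≈ x
    cancel {u} {v} uv≈1 x = trans (sym (*-assoc u v x)) (trans (*-congʳ uv≈1) (*-identityˡ x))
    ω^b≈1 : ω ^ b ≈ 1#
    ω^b≈1 = *-cancelˡ-≉0 neq (begin
      ∑F (_^ b) * ω ^ b           ≈⟨ *-comm _ _ ⟩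
      ω ^ b * ∑F (_^ b)           ≈⟨ ∑F-*ˡ (ω ^ b) (_^ b) ⟨
      ∑F (λ x → ω ^ b * x ^ b)    ≈⟨ ∑F-cong (λ x → ^-distrib-* ω x b) ⟨
      ∑F (λ x → (ω * x) ^ b)      ≈⟨ ∑F-reindex {π = ω *_} {ρ = ω⁻¹ *_} {g = _^ b}
                                       (λ _ _ → *-congˡ) (λ _ _ → *-congˡ)
                                       (cancel inv) (cancel (trans (*-comm _ _) inv)) (λ _ _ → ^-congˡ b) ⟨
      ∑F (_^ b)                   ≈⟨ *-identityʳ _ ⟨
      ∑F (_^ b) * 1#              ∎)
    b-excluded : ¬ Q ≤ b
    b-excluded Q≤b = ℕₚ.<⇒≱ b<2Q (≡.subst (Q +ℕ Q ≤_) (ℕₚ.m+[n∸m]≡n Q≤b) (ℕₚ.+-monoʳ-≤ Q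
      (ω-order-minimal (ℕₚ.m<n⇒0<n∸m (ℕₚ.≤∧≢⇒< Q≤b (b≢Q ∘ ≡.sym))) (*-cancelˡ-≉0 (^-≉0 ω≉0 Q) (begin
        ω ^ Q * ω ^ (b ∸ Q)   ≈⟨ ^-homo-* ω Q (b ∸ Q) ⟨
        ω ^ (Q +ℕ (b ∸ Q))    ≈⟨ ^-congʳ ω (ℕₚ.m+[n∸m]≡n Q≤b) ⟩
        ω ^ b                 ≈⟨ trans ω^b≈1 (sym ω^Q≈1) ⟩
        ω ^ Q                 ≈⟨ *-identityʳ _ ⟨
        ω ^ Q * 1#            ∎)))))

  -- By Fermat, 1 - x^Q is the indicator function of 0, with sum 1, whereas the constant 1 has sum
  -- 0.
  ∑F-^Q≈-1 : ∑F (_^ Q) ≈ - 1#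
  ∑F-^Q≈-1 = +-cancelˡ 1# _ _ (begin
    1# + ∑F (_^ Q)             ≈⟨ +-congʳ (trans (+-congˡ (trans (-‿cong (0^n≈0 0<Q refl)) -0#≈0#)) (+-identityʳ 1#)) ⟨
    g 0# + ∑F (_^ Q)           ≈⟨ +-congʳ (∑F-single g 0# (λ _ _ eq → +-congˡ (-‿cong (^-congˡ Q eq))) vanish) ⟨
    ∑F g + ∑F (_^ Q)           ≈⟨ ∑F-+ _ _ ⟨
    ∑F (λ x → g x + x ^ Q)     ≈⟨ ∑F-cong (λ x → [x-y]+y≈x 1# (x ^ Q)) ⟩
    ∑F (λ _ → 1#)              ≈⟨ trans ∑F-1 ι-size≈0 ⟩
    0#                         ≈⟨ -‿inverseʳ 1# ⟨
    1# - 1#                    ∎)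
    where
    g : Carrier → Carrier
    g x = 1# - x ^ Q
    vanish : ∀ x → ¬ x ≈ 0# → g x ≈ 0#
    vanish x x≉0 = trans (+-congˡ (-‿cong (fermat x≉0))) (-‿inverseʳ 1#)

  -- After expansion only the summand in which `y` has exponent exactly `Q` survives; the bound on n
  -- + c keeps all exponents below 2Q. If Q - c > n there is no such summand, and the binomial
  -- coefficient on the right is 0.
  ∑F-binomial : ∀ {n c} z → n +ℕ c < Q +ℕ Q → c ≤ Q →
                ∑F (λ y → (y + z) ^ n * y ^ c) ≈ - (bin n (Q ∸ c) * z ^ (n ∸ (Q ∸ c)))
  ∑F-binomial {n} {c} z n+c<2Q c≤Q = begin
    ∑F (λ y → (y + z) ^ n * y ^ c)            ≈⟨ ∑F-cong expand ⟩
    ∑F (λ y → sum (λ i → coeff i * y ^ (toℕ i +ℕ c)))   ≈⟨ ∑F-sum (λ i y → coeff i * y ^ (toℕ i +ℕ c)) ⟩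
    sum (λ i → ∑F (λ y → coeff i * y ^ (toℕ i +ℕ c)))   ≈⟨ sum-cong-≋ {suc n} (λ i → ∑F-*ˡ (coeff i) (_^ (toℕ i +ℕ c))) ⟩
    sum t                                     ≈⟨ evaluate ⟩
    - (bin n (Q ∸ c) * z ^ (n ∸ (Q ∸ c)))     ∎
    where
    coeff : Fin (suc n) → Carrier
    coeff i = bin n (toℕ i) * z ^ (n ∸ toℕ i)
    t : Fin (suc n) → Carrier
    t i = coeff i * ∑F (_^ (toℕ i +ℕ c))
    expand : ∀ y → (y + z) ^ n * y ^ c ≈ sum (λ i → coeff i * y ^ (toℕ i +ℕ c))
    expand y = begin
      (y + z) ^ n * y ^ c            ≈⟨ *-congʳ (binomial n y z) ⟩
      sum u * y ^ c                  ≈⟨ *-distribʳ-sum {suc n} (y ^ c) u ⟩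
      sum {suc n} (λ i → u i * y ^ c) ≈⟨ sum-cong-≋ {suc n} (λ i → trans
        (solve 4 (λ b u v w → (b :* (u :* v)) :* w := (b :* v) :* (u :* w)) refl (bin n (toℕ i)) (y ^ toℕ i) (z ^ (n ∸ toℕ i)) (y ^ c))
        (*-congˡ (sym (^-homo-* y (toℕ i) c)))) ⟩
      sum {suc n} (λ i → coeff i * y ^ (toℕ i +ℕ c)) ∎
      where
      u : Fin (suc n) → Carrier
      u i = bin n (toℕ i) * (y ^ toℕ i * z ^ (n ∸ toℕ i))
    off : ∀ i → toℕ i +ℕ c ≢ Q → t i ≈ 0#
    off i ≢Q = trans (*-congˡ (∑F-^≈0 (ℕₚ.≤-<-trans (ℕₚ.+-monoˡ-≤ c (ℕ.s≤s⁻¹ (Finₚ.toℕ<n i))) n+c<2Q) ≢Q)) (zeroʳ _)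
    evaluate : sum t ≈ - (bin n (Q ∸ c) * z ^ (n ∸ (Q ∸ c)))
    evaluate with Q ∸ c ℕ.≤? n
    ... | no Q∸c≰n = trans (sum-zero t (λ i → off i (λ eq → Q∸c≰n (≡.subst (_≤ n)
                       (≡.trans (≡.sym (ℕₚ.m+n∸n≡m (toℕ i) c)) (≡.cong (_∸ c) eq)) (ℕ.s≤s⁻¹ (Finₚ.toℕ<n i))))))
                       (sym (trans (-‿cong (trans (*-congʳ (bin-> (ℕₚ.≰⇒> Q∸c≰n))) (zeroˡ _))) -0#≈0#))
    ... | yes Q∸c≤n = begin
      sum t      ≈⟨ sum-single t i₀ (λ j j≢i₀ → off j (λ eq → j≢i₀ (Finₚ.toℕ-injective
                      (≡.trans (≡.trans (≡.sym (ℕₚ.m+n∸n≡m (toℕ j) c)) (≡.cong (_∸ c) eq)) (≡.sym toℕ-i₀))))) ⟩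
      coeff i₀ * ∑F (_^ (toℕ i₀ +ℕ c))
        ≈⟨ reflexive (≡.cong (λ j → (bin n j * z ^ (n ∸ j)) * ∑F (_^ (j +ℕ c))) toℕ-i₀) ⟩
      (bin n (Q ∸ c) * z ^ (n ∸ (Q ∸ c))) * ∑F (_^ ((Q ∸ c) +ℕ c))
        ≈⟨ *-congˡ (trans (reflexive (≡.cong (λ b → ∑F (_^ b)) (ℕₚ.m∸n+n≡m c≤Q))) ∑F-^Q≈-1) ⟩
      (bin n (Q ∸ c) * z ^ (n ∸ (Q ∸ c))) * - 1#
        ≈⟨ trans (sym (-‿distribʳ-* _ 1#)) (-‿cong (*-identityʳ _)) ⟩
      - (bin n (Q ∸ c) * z ^ (n ∸ (Q ∸ c))) ∎
      where
      i₀ : Fin (suc n)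
      i₀ = fromℕ< (s≤s Q∸c≤n)
      toℕ-i₀ : toℕ i₀ ≡ Q ∸ c
      toℕ-i₀ = Finₚ.toℕ-fromℕ< (s≤s Q∸c≤n)

-- Polynomial functions in `φ` and their degrees.

module Polynomials {c ℓ : Level} (F : CommutativeRing c ℓ) (isField : IsField F) {q : ℕ} (size : HasSize F q)
                   (φ : CommutativeRing.Carrier F → CommutativeRing.Carrier F) where
  open FiniteField F isField size

  private
    variable
      m n : ℕ
      g g′ h : Carrier → Carrier

  -- Functions given by a polynomial in `φ x` of degree less than the index. Kernels use `φ` = z^m,
  -- automorphisms use the identity.
  data Below : ℕ → (Carrier → Carrier) → Set (c ⊔ ℓ) where
    no-terms : (∀ x → g x ≈ 0#) → Below 0 g
    add-term : ∀ a → Below n h → (∀ x → g x ≈ h x + a * φ x ^ n) → Below (suc n) g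

  -- The degree belongs to a chosen representation: modulo x^q - x a function has many, and
  -- uniqueness needs a separate bound.
  Exact : ℕ → (Carrier → Carrier) → Set (c ⊔ ℓ)
  Exact n g = Σ Carrier λ a → Σ (Carrier → Carrier) λ h → ¬ a ≈ 0# × Below n h × (∀ x → g x ≈ h x + a * φ x ^ n)

  Below-resp : (∀ x → g′ x ≈ g x) → Below n g → Below n g′
  Below-resp eq (no-terms g≈0)    = no-terms (λ x → trans (eq x) (g≈0 x))
  Below-resp eq (add-term a b g≈) = add-term a b (λ x → trans (eq x) (g≈ x))

  private
    x+ay≈x : ∀ {a x y} → a ≈ 0# → x + a * y ≈ x
    x+ay≈x a≈0 = trans (+-congˡ (trans (*-congʳ a≈0) (zeroˡ _))) (+-identityʳ _)

  Below-suc : Below n g → Below (suc n) g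
  Below-suc b = add-term 0# b (λ x → sym (x+ay≈x refl))

  Below-≤ : m ≤ n → Below m g → Below n g
  Below-≤ m≤n = go (ℕₚ.≤⇒≤′ m≤n)
    where
    go : m ℕ.≤′ n → Below m g → Below n g
    go (ℕ.≤′-reflexive ≡.refl) b = b
    go (ℕ.≤′-step m≤′n)        b = Below-suc (go m≤′n b)

  Below-0 : ∀ n → (∀ x → g x ≈ 0#) → Below n g
  Below-0 n g≈0 = Below-≤ z≤n (no-terms g≈0)

  Below-+ : Below n g → Below n h → Below n (λ x → g x + h x)
  Below-+ (no-terms g≈0)    (no-terms h≈0)    = no-terms (λ x → trans (+-cong (g≈0 x) (h≈0 x)) (+-identityˡ 0#))
  Below-+ (add-term a b g≈) (add-term a′ b′ h≈) = add-term (a + a′) (Below-+ b b′) λ x → trans (+-cong (g≈ x) (h≈ x))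
    (solve 5 (λ u a v b y → (u :+ a :* y) :+ (v :+ b :* y) := (u :+ v) :+ (a :+ b) :* y) refl _ a _ a′ _)

  Below-*ˡ : ∀ s → Below n g → Below n (λ x → s * g x)
  Below-*ˡ s (no-terms g≈0)    = no-terms (λ x → trans (*-congˡ (g≈0 x)) (zeroʳ s))
  Below-*ˡ s (add-term a b g≈) = add-term (s * a) (Below-*ˡ s b) λ x → trans (*-congˡ (g≈ x))
    (solve 4 (λ s u a y → s :* (u :+ a :* y) := s :* u :+ (s :* a) :* y) refl s _ a _)

  Below-φ* : Below n g → Below (suc n) (λ x → φ x * g x)
  Below-φ* (no-terms g≈0)    = Below-0 1 (λ x → trans (*-congˡ (g≈0 x)) (zeroʳ _))
  Below-φ* (add-term a b g≈) = add-term a (Below-φ* b) λ x → trans (*-congˡ (g≈ x))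
    (solve 4 (λ p u a y → p :* (u :+ a :* y) := p :* u :+ a :* (p :* y)) refl _ _ a _)

  Below-φ^* : ∀ i → Below n g → Below (i +ℕ n) (λ x → φ x ^ i * g x)
  Below-φ^* zero    b = Below-resp (λ x → *-identityˡ _) b
  Below-φ^* (suc i) b = Below-resp (λ x → *-assoc _ _ _) (Below-φ* (Below-φ^* i b))

  Below-φ^ : m < n → Below n (λ x → φ x ^ m)
  Below-φ^ {m} m<n = Below-≤ m<n (add-term 1# (Below-0 m (λ _ → refl)) (λ x → sym (trans (+-identityˡ _) (*-identityˡ _))))

  -- Degrees below `m` and at most `n` give a product of degree below m + n; the successor on one
  -- side avoids a truncated subtraction.
  Below-* : Below m g → Below (suc n) h → Below (m +ℕ n) (λ x → g x * h x)
  Below-* {n = n} (no-terms g≈0) _ = Below-0 n (λ x → trans (*-congʳ (g≈0 x)) (zeroˡ _))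
  Below-* {m = suc m} {n = n} (add-term a b g≈) b′ = Below-resp
    (λ x → trans (*-congʳ (g≈ x)) (solve 4 (λ u a y v → (u :+ a :* y) :* v := u :* v :+ a :* (y :* v)) refl _ a _ _))
    (Below-+ (Below-suc (Below-* b b′))
             (Below-*ˡ a (Below-≤ (ℕₚ.≤-reflexive (ℕₚ.+-suc m n)) (Below-φ^* m b′))))

  Below-sum : ∀ {r} (g : Fin r → Carrier → Carrier) → (∀ i → Below n (g i)) → Below n (λ x → sum (λ i → g i x))
  Below-sum {r = zero}  g bs = Below-0 _ (λ _ → refl)
  Below-sum {r = suc r} g bs = Below-+ (bs zero) (Below-sum (g ∘ suc) (bs ∘ suc))

  opaque
    unfolding ∑F

    Below-∑F : ∀ (g : Carrier → Carrier → Carrier) → (∀ v → Below n (g v)) → Below n (λ x → ∑F (λ v → g v x))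
    Below-∑F g bs = Below-sum (λ i → g (proj₁ (proj₂ size) i)) (λ i → bs _)

  Exact-resp : (∀ x → g′ x ≈ g x) → Exact n g → Exact n g′
  Exact-resp eq (a , h , a≉0 , b , g≈) = a , h , a≉0 , b , λ x → trans (eq x) (g≈ x)

  Exact⇒Below : Exact n g → Below (suc n) g
  Exact⇒Below (a , h , _ , b , g≈) = add-term a b g≈

  Exact-+ˡ : Exact n g → Below n h → Exact n (λ x → g x + h x)
  Exact-+ˡ (a , g₀ , a≉0 , b , g≈) b′ = a , _ , a≉0 , Below-+ b b′ , λ x → trans (+-congʳ (g≈ x))
    (solve 3 (λ u v w → (u :+ v) :+ w := (u :+ w) :+ v) refl _ _ _)

  Exact-sum : ∀ {r} (g : Fin r → Carrier → Carrier) i₀ → Exact n (g i₀) → (∀ i → i ≢ i₀ → Below n (g i)) →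
              Exact n (λ x → sum (λ i → g i x))
  Exact-sum g zero     ex bs = Exact-+ˡ ex (Below-sum (g ∘ suc) (λ i → bs (suc i) λ ()))
  Exact-sum g (suc i₀) ex bs = Exact-resp (λ x → +-comm _ _)
    (Exact-+ˡ (Exact-sum (g ∘ suc) i₀ ex (λ i i≢ → bs (suc i) (i≢ ∘ Finₚ.suc-injective))) (bs zero λ ()))

  Exact-φ^ : ∀ n → Exact n (λ x → φ x ^ n)
  Exact-φ^ n = 1# , (λ _ → 0#) , 1≉0 , Below-0 n (λ _ → refl) , λ x → sym (trans (+-identityˡ _) (*-identityˡ _))

  Exact-*ˡ : ∀ {s} → ¬ s ≈ 0# → Exact n g → Exact n (λ x → s * g x)
  Exact-*ˡ {s = s} s≉0 (a , h , a≉0 , b , g≈) = s * a , _ , *-≉0 s≉0 a≉0 , Below-*ˡ s b , λ x → trans (*-congˡ (g≈ x))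
    (solve 4 (λ s u a y → s :* (u :+ a :* y) := s :* u :+ (s :* a) :* y) refl s _ a _)

  Exact-* : Exact m g → Exact n h → Exact (m +ℕ n) (λ x → g x * h x)
  Exact-* {m} {n = n} (a , g₀ , a≉0 , b , g≈) ex@(a′ , h₀ , a′≉0 , b′ , h≈) =
    a * a′ , _ , *-≉0 a≉0 a′≉0 ,
    Below-+ (Below-* b (Exact⇒Below ex)) (Below-*ˡ a (Below-φ^* m b′)) , λ x →
    trans (*-congʳ (g≈ x)) (trans
      (solve 4 (λ u a y v → (u :+ a :* y) :* v := u :* v :+ a :* (y :* v)) refl _ a _ _)
      (trans (+-congˡ (*-congˡ (*-congˡ (h≈ x)))) (trans
        (solve 6 (λ w a y v b z → w :+ a :* (y :* (v :+ b :* z)) := (w :+ a :* (y :* v)) :+ (a :* b) :* (y :* z)) refl _ a _ _ a′ _)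
        (+-congˡ (*-congˡ (sym (^-homo-* (φ x) m n)))))))

  Exact-^ : ∀ i → Exact n g → Exact (i *ℕ n) (λ x → g x ^ i)
  Exact-^ zero    ex = Exact-φ^ 0
  Exact-^ (suc i) ex = Exact-* ex (Exact-^ i ex)

  zero⊎Exact : Below n g → (∀ x → g x ≈ 0#) ⊎ (∃ λ d → d < n × Exact d g)
  zero⊎Exact (no-terms g≈0) = inj₁ g≈0
  zero⊎Exact (add-term {n} a b g≈) with a ≟ 0#
  ... | no a≉0 = inj₂ (n , ℕₚ.n<1+n n , a , _ , a≉0 , b , g≈)
  ... | yes a≈0 with zero⊎Exact b
  ...   | inj₁ h≈0            = inj₁ (λ x → trans (trans (g≈ x) (x+ay≈x a≈0)) (h≈0 x))
  ...   | inj₂ (d , d<n , ex) = inj₂ (d , ℕₚ.m<n⇒m<1+n d<n , Exact-resp (λ x → trans (g≈ x) (x+ay≈x a≈0)) ex)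

-- The connection set as the kernel of z ↦ z^m, and the convolution that lowers degrees.

module ConnectionSet {c ℓ : Level} (F : CommutativeRing c ℓ) (isField : IsField F) {k e R : ℕ} (p-prime : Prime (suc (k *ℕ e)))
                     (size : HasSize F (suc (k *ℕ e) ^ℕ R)) (2≤k : 2 ≤ k)
                     (ω : CommutativeRing.Carrier F) (generates : IsPrimitive F ω) where

  2<p : 0 < e → 2 < suc (k *ℕ e)
  2<p 0<e = s≤s (ℕₚ.*-mono-≤ 2≤k 0<e)

  0<e : 0 < e
  0<e = ℕₚ.n≢0⇒n>0 λ e≡0 → ℕₚ.<-irrefl ≡.refl (≡.subst (2 ≤_)
    (≡.cong suc (≡.trans (≡.cong (k *ℕ_) e≡0) (ℕₚ.*-zeroʳ k)))
    (ℕ.nonTrivial⇒n>1 _ {{prime⇒nonTrivial p-prime}}))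

  open PrimitiveElement F isField {k *ℕ e} {R} p-prime size (2<p 0<e) ω generates public
  open GPaley F ω k

  opaque
    m : ℕ
    m = e *ℕ repunit p R

    m≡e*repunit : m ≡ e *ℕ repunit p R
    m≡e*repunit = ≡.refl

  Q≡k*m : Q ≡ k *ℕ m
  Q≡k*m = ≡.trans Q≡d*repunit (≡.trans (ℕₚ.*-assoc k e (repunit p R)) (≡.cong (k *ℕ_) (≡.sym m≡e*repunit)))

  0<m : 0 < m
  0<m = ℕₚ.n≢0⇒n>0 λ m≡0 → ℕₚ.<-irrefl (≡.sym (≡.trans Q≡k*m (≡.trans (≡.cong (k *ℕ_) m≡0) (ℕₚ.*-zeroʳ k)))) 0<Q

  S⇒^m≈1 : ∀ {z} → (∃ λ j → z ≈ pow F ω (j *ℕ k)) → z ^ m ≈ 1#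
  S⇒^m≈1 {z} (j , eq) = begin
    z ^ m                    ≈⟨ ^-congˡ m (trans eq (reflexive (pow≡^ ω (j *ℕ k)))) ⟩
    (ω ^ (j *ℕ k)) ^ m       ≈⟨ ^-congˡ m (^-assocʳ ω j k) ⟨
    ((ω ^ j) ^ k) ^ m        ≈⟨ ^-assocʳ (ω ^ j) k m ⟩
    (ω ^ j) ^ (k *ℕ m)       ≈⟨ ^-congʳ (ω ^ j) Q≡k*m ⟨
    (ω ^ j) ^ Q              ≈⟨ fermat (^-≉0 ω≉0 j) ⟩
    1#                       ∎

  ^m≈1⇒≉0 : ∀ {z} → z ^ m ≈ 1# → ¬ z ≈ 0#
  ^m≈1⇒≉0 z^m≈1 z≈0 = 1≉0 (trans (sym z^m≈1) (0^n≈0 0<m z≈0))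

  ω-order∣ : ∀ {j} → ω ^ j ≈ 1# → Q ∣ j
  ω-order∣ {j} ω^j≈1 = go {{ℕ.>-nonZero 0<Q}}
    where
    r≡0 : ∀ r → r < Q → ω ^ r ≈ 1# → r ≡ 0
    r≡0 zero    _   _     = ≡.refl
    r≡0 (suc r) r<Q ω^r≈1 = ⊥-elim (ℕₚ.<⇒≱ r<Q (ω-order-minimal (s≤s z≤n) ω^r≈1))
    go : {{_ : NonZero Q}} → Q ∣ j
    go = m%n≡0⇒n∣m j Q (r≡0 (j % Q) (m%n<n j Q) (trans (sym (^-periodic {Q} ω^Q≈1 j)) ω^j≈1))

  -- For z = ω^j the hypothesis says that Q = k m divides j m; cancelling `m` shows that `k` divides
  -- the exponent.
  ^m≈1⇒S : ∀ {z} → z ^ m ≈ 1# → ∃ λ j → z ≈ pow F ω (j *ℕ k)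
  ^m≈1⇒S {z} z^m≈1 = quotient k∣j , (begin
    z                             ≈⟨ z≈ω^j ⟩
    ω ^ j                         ≈⟨ ^-congʳ ω (_∣_.equality k∣j) ⟩
    ω ^ (quotient k∣j *ℕ k)       ≡⟨ pow≡^ ω (quotient k∣j *ℕ k) ⟨
    pow F ω (quotient k∣j *ℕ k)   ∎)
    where
    j = proj₁ (log z (^m≈1⇒≉0 z^m≈1))
    z≈ω^j : z ≈ ω ^ j
    z≈ω^j = proj₂ (log z (^m≈1⇒≉0 z^m≈1))
    ω^[j*m]≈1 : ω ^ (j *ℕ m) ≈ 1#
    ω^[j*m]≈1 = begin
      ω ^ (j *ℕ m)  ≈⟨ ^-assocʳ ω j m ⟨
      (ω ^ j) ^ m   ≈⟨ ^-congˡ m z≈ω^j ⟨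
      z ^ m         ≈⟨ z^m≈1 ⟩
      1#            ∎
    k∣j : k ∣ j
    k∣j = *-cancelʳ-∣ {k} {j} m {{ℕ.>-nonZero 0<m}} (≡.subst (_∣ j *ℕ m) Q≡k*m (ω-order∣ {j *ℕ m} ω^[j*m]≈1))

  Adj⇒^m≈1 : ∀ {u v} → Adj u v → (v - u) ^ m ≈ 1#
  Adj⇒^m≈1 = S⇒^m≈1

  ^m≈1⇒Adj : ∀ {u v} → (v - u) ^ m ≈ 1# → Adj u v
  ^m≈1⇒Adj = ^m≈1⇒S
 

  open Polynomials F isField size (_^ m)

  suc-pred-k : suc (ℕ.pred k) ≡ k
  suc-pred-k = ℕₚ.suc-pred k {{ℕ.>-nonZero (ℕₚ.<-trans (s≤s z≤n) 2≤k)}}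

  pred<k : ℕ.pred k < k
  pred<k = ℕₚ.≤-reflexive suc-pred-k

  -- The identity (u - 1) G = u^n - 1 with the negative terms moved across, as the solver works in
  -- semirings.
  geometric : ∀ u n → u * sum {n} (λ i → u ^ toℕ i) + 1# ≈ sum {n} (λ i → u ^ toℕ i) + u ^ n
  geometric u zero    = +-congʳ (zeroʳ u)
  geometric u (suc n) = begin
    u * (1# + sum {n} (λ i → u * u ^ toℕ i)) + 1#  ≈⟨ +-congʳ (*-congˡ shift) ⟩
    u * (1# + u * G) + 1#                          ≈⟨ +-congʳ (*-congˡ (+-comm 1# (u * G))) ⟩
    u * (u * G + 1#) + 1#                          ≈⟨ +-congʳ (*-congˡ (geometric u n)) ⟩
    u * (G + u ^ n) + 1#                           ≈⟨ solve 4 (λ u G v o → u :* (G :+ v) :+ o := (o :+ u :* G) :+ u :* v) refl u G (u ^ n) 1# ⟩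
    (1# + u * G) + u * u ^ n                       ≈⟨ +-congʳ shift ⟨
    (1# + sum {n} (λ i → u * u ^ toℕ i)) + u * u ^ n ∎
    where
    G : Carrier
    G = sum {n} (λ i → u ^ toℕ i)
    shift : 1# + sum {n} (λ i → u * u ^ toℕ i) ≈ 1# + u * G
    shift = +-congˡ (sym (*-distribˡ-sum {n} u (λ i → u ^ toℕ i)))

  -- B is k on S, 1 at 0 and 0 elsewhere: the kernel of a multiple of A - m, where A is the
  -- adjacency operator over F (note that k m = -1 in F).
  B : Carrier → Carrier
  B z = sum {k} (λ i → (z ^ m) ^ toℕ i)

  B-cong : ∀ {z z′} → z ^ m ≈ z′ ^ m → B z ≈ B z′
  B-cong eq = sum-cong-≋ {k} (λ i → ^-congˡ (toℕ i) eq)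

  -- Since (z^m)^k = z^Q = 1, multiplication by z^m fixes the geometric sum; a nonzero value would
  -- give z^m = 1.
  B≈0 : ∀ {z} → ¬ z ≈ 0# → ¬ z ^ m ≈ 1# → B z ≈ 0#
  B≈0 {z} z≉0 z^m≉1 with B z ≟ 0#
  ... | yes eq = eq
  ... | no Bz≉0 = ⊥-elim (z^m≉1 (*-cancelˡ-≉0 Bz≉0 (begin
    B z * z ^ m      ≈⟨ *-comm _ _ ⟩
    z ^ m * B z      ≈⟨ +-cancelʳ 1# _ _ (trans (geometric (z ^ m) k) (+-congˡ (begin
      (z ^ m) ^ k      ≈⟨ trans (^-swap z m k) (^-assocʳ z k m) ⟩
      z ^ (k *ℕ m)     ≈⟨ ^-congʳ z Q≡k*m ⟨
      z ^ Q            ≈⟨ fermat z≉0 ⟩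
      1#               ∎))) ⟩
    B z              ≈⟨ *-identityʳ _ ⟨
    B z * 1#         ∎)))

  B≉0⇒0⊎S : ∀ {z} → ¬ B z ≈ 0# → (z ≈ 0#) ⊎ (z ^ m ≈ 1#)
  B≉0⇒0⊎S {z} Bz≉0 with z ≟ 0# | z ^ m ≟ 1#
  ... | yes z≈0 | _         = inj₁ z≈0
  ... | no _    | yes z^m≈1 = inj₂ z^m≈1
  ... | no z≉0  | no z^m≉1  = ⊥-elim (Bz≉0 (B≈0 z≉0 z^m≉1))

  -- The base-`p` digits of m a are all e a, and e a ≤ e k = p - 1, so no carries occur. By Lucas
  -- the binomial coefficient is a product of copies of C(e a, e), which is nonzero in F.
  bin-multiple≉0 : ∀ {a} → 1 ≤ a → a ≤ k → ¬ bin (m *ℕ a) m ≈ 0#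
  bin-multiple≉0 {a} 1≤a a≤k eq = go R (trans (ι-cong (≡.cong (λ m → (m *ℕ a) C m) (≡.sym m≡e*repunit))) eq)
    where
    ea<p : e *ℕ a < p
    ea<p = s≤s (≡.subst (e *ℕ a ≤_) (ℕₚ.*-comm e k) (ℕₚ.*-monoʳ-≤ e a≤k))
    e≤ea : e ≤ e *ℕ a
    e≤ea = ≡.subst (_≤ e *ℕ a) (ℕₚ.*-identityʳ e) (ℕₚ.*-monoʳ-≤ e 1≤a)
    swap : ∀ x y → x *ℕ y *ℕ a ≡ x *ℕ a *ℕ y
    swap x y = ≡.trans (ℕₚ.*-assoc x y a) (≡.trans (≡.cong (x *ℕ_) (ℕₚ.*-comm y a)) (≡.sym (ℕₚ.*-assoc x a y)))
    -- Induction on the number of digits: each step splits off the lowest digits e a and e.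
    go : ∀ r → ¬ bin (e *ℕ repunit p r *ℕ a) (e *ℕ repunit p r) ≈ 0#
    go zero eq = 1≉0 (trans (sym (trans (ι-cong (≡.cong (λ x → (x *ℕ a) C x) (ℕₚ.*-zeroʳ e))) (bin-0 0))) eq)
    go (suc r) eq = *-≉0 (go r) (bin-digit≉0 e≤ea ea<p) (begin
      bin (e *ℕ M *ℕ a) (e *ℕ M) * bin (e *ℕ a) e   ≈⟨ lucas (e *ℕ M *ℕ a) (e *ℕ M) ea<p (ℕₚ.≤-<-trans e≤ea ea<p) ⟨
      bin (e *ℕ a +ℕ e *ℕ M *ℕ a *ℕ p) (e +ℕ e *ℕ M *ℕ p)
        ≈⟨ ι-cong (≡.cong₂ _C_ (≡.trans (≡.cong (λ x → e *ℕ a +ℕ x *ℕ p) (swap e M))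
             (≡.trans (≡.sym (*-repunit-suc p (e *ℕ a) M)) (≡.sym (swap e (suc (p *ℕ M)))))) (≡.sym (*-repunit-suc p e M))) ⟩
      bin (e *ℕ suc (p *ℕ M) *ℕ a) (e *ℕ suc (p *ℕ M))   ≈⟨ eq ⟩
      0# ∎)
      where M = repunit p r

  conv : (Carrier → Carrier) → Carrier → Carrier
  conv N z = ∑F (λ y → N (y + z) * B y)

  -- What the summand of `B` with exponent k - r contributes to the convolution of (z^m)^a: the
  -- degree drops by `r`, and `r` runs through 1, ..., k.
  convTerm : ℕ → ℕ → Carrier → Carrier
  convTerm a r z = - (bin (m *ℕ a) (m *ℕ r)) * (z ^ m) ^ (a ∸ r)

  conv-power : ∀ {a} → a < k → ∀ z → conv (λ y → (y ^ m) ^ a) z ≈ sum {k} (λ i → convTerm a (k ∸ toℕ i) z)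
  conv-power {a} a<k z = begin
    ∑F (λ y → ((y + z) ^ m) ^ a * B y)
      ≈⟨ ∑F-cong (λ y → *-distribˡ-sum {k} (((y + z) ^ m) ^ a) (λ i → (y ^ m) ^ toℕ i)) ⟩
    ∑F (λ y → sum {k} (λ i → ((y + z) ^ m) ^ a * (y ^ m) ^ toℕ i))
      ≈⟨ ∑F-cong (λ y → sum-cong-≋ {k} (λ i → *-cong (^-assocʳ (y + z) m a) (^-assocʳ y m (toℕ i)))) ⟩
    ∑F (λ y → sum {k} (λ i → (y + z) ^ (m *ℕ a) * y ^ (m *ℕ toℕ i)))
      ≈⟨ ∑F-sum {k} (λ i y → (y + z) ^ (m *ℕ a) * y ^ (m *ℕ toℕ i)) ⟩
    sum {k} (λ i → ∑F (λ y → (y + z) ^ (m *ℕ a) * y ^ (m *ℕ toℕ i)))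
      ≈⟨ sum-cong-≋ {k} (λ i → term (toℕ i) (Finₚ.toℕ<n i)) ⟩
    sum {k} (λ i → convTerm a (k ∸ toℕ i) z) ∎
    where
    Q≡m*k : Q ≡ m *ℕ k
    Q≡m*k = ≡.trans Q≡k*m (ℕₚ.*-comm k m)
    m*<Q : ∀ {b} → b < k → m *ℕ b < Q
    m*<Q b<k = ≡.subst (m *ℕ _ <_) (≡.sym Q≡m*k) (ℕₚ.*-monoʳ-< m {{ℕ.>-nonZero 0<m}} b<k)
    term : ∀ b → b < k → ∑F (λ y → (y + z) ^ (m *ℕ a) * y ^ (m *ℕ b)) ≈ convTerm a (k ∸ b) z
    term b b<k = begin
      ∑F (λ y → (y + z) ^ (m *ℕ a) * y ^ (m *ℕ b))
        ≈⟨ ∑F-binomial z (ℕₚ.+-mono-< (m*<Q a<k) (m*<Q b<k)) (ℕₚ.<⇒≤ (m*<Q b<k)) ⟩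
      - (bin (m *ℕ a) (Q ∸ m *ℕ b) * z ^ (m *ℕ a ∸ (Q ∸ m *ℕ b)))
        ≈⟨ reflexive (≡.cong (λ x → - (bin (m *ℕ a) x * z ^ (m *ℕ a ∸ x)))
             (≡.trans (≡.cong (_∸ m *ℕ b) Q≡m*k) (≡.sym (ℕₚ.*-distribˡ-∸ m k b)))) ⟩
      - (bin (m *ℕ a) (m *ℕ (k ∸ b)) * z ^ (m *ℕ a ∸ m *ℕ (k ∸ b)))
        ≈⟨ -‿cong (*-congˡ (trans (^-congʳ z (≡.sym (ℕₚ.*-distribˡ-∸ m a (k ∸ b)))) (sym (^-assocʳ z m (a ∸ (k ∸ b)))))) ⟩
      - (bin (m *ℕ a) (m *ℕ (k ∸ b)) * (z ^ m) ^ (a ∸ (k ∸ b)))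
        ≈⟨ -‿distribˡ-* _ _ ⟩
      convTerm a (k ∸ b) z ∎

  convTerm-Below : ∀ {a r s} → s < r → Below (a ∸ s) (convTerm a r)
  convTerm-Below {a} {r} {s} s<r with r ℕ.≤? a
  ... | yes r≤a = Below-*ˡ _ (Below-φ^ (ℕₚ.∸-monoʳ-< s<r r≤a))
  -- Truncation makes the exponent 0 here, but the binomial coefficient vanishes.
  ... | no r≰a  = Below-0 (a ∸ s) (λ x → trans (*-congʳ (trans (-‿cong
    (bin-> (ℕₚ.*-monoʳ-< m {{ℕ.>-nonZero 0<m}} (ℕₚ.≰⇒> r≰a)))) -0#≈0#)) (zeroˡ _))

  conv-power-Below : ∀ {a} → a < k → Below a (conv (λ y → (y ^ m) ^ a))
  conv-power-Below {a} a<k = Below-resp (conv-power a<k)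
    (Below-sum {r = k} (λ i → convTerm a (k ∸ toℕ i)) (λ i → convTerm-Below (ℕₚ.m<n⇒0<n∸m (Finₚ.toℕ<n i))))

  -- Only r = 1, coming from the last summand of `B`, reaches degree `a`. Its coefficient is - C(m
  -- (a + 1), m), nonzero by `bin-multiple≉0`.
  conv-power-Exact : ∀ {a} → suc a < k → Exact a (conv (λ y → (y ^ m) ^ suc a))
  conv-power-Exact {a} a<k = Exact-resp (conv-power a<k)
    (Exact-sum {r = k} (λ i → convTerm (suc a) (k ∸ toℕ i)) i₀
      (≡.subst (λ r → Exact a (convTerm (suc a) r)) (≡.sym k∸i₀≡1)
        (Exact-*ˡ (-‿≉0 (λ eq → bin-multiple≉0 (s≤s z≤n) (ℕₚ.<⇒≤ a<k)
          (trans (ι-cong (≡.cong ((m *ℕ suc a) C_) (≡.sym (ℕₚ.*-identityʳ m)))) eq))) (Exact-φ^ a)))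
      (λ i i≢i₀ → convTerm-Below {suc a} (1<k∸i i i≢i₀)))
    where
    i₀ : Fin k
    i₀ = fromℕ< pred<k
    k∸pred≡1 : k ∸ ℕ.pred k ≡ 1
    k∸pred≡1 = ≡.trans (≡.cong (_∸ ℕ.pred k) (≡.sym (suc-pred-k))) (ℕₚ.m+n∸n≡m 1 (ℕ.pred k))
    k∸i₀≡1 : k ∸ toℕ i₀ ≡ 1
    k∸i₀≡1 = ≡.trans (≡.cong (k ∸_) (Finₚ.toℕ-fromℕ< pred<k)) k∸pred≡1
    1<k∸i : ∀ i → i ≢ i₀ → 1 < k ∸ toℕ i
    1<k∸i i i≢i₀ = ≡.subst (_< k ∸ toℕ i) k∸pred≡1 (ℕₚ.∸-monoʳ-< (ℕₚ.≤∧≢⇒< (ℕₚ.<⇒≤pred (Finₚ.toℕ<n i))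
      (λ eq → i≢i₀ (Finₚ.toℕ-injective (≡.trans eq (≡.sym (Finₚ.toℕ-fromℕ< pred<k)))))) (ℕₚ.<⇒≤ pred<k))

  conv-+* : ∀ {N N₁ N₂ a} → (∀ x → N x ≈ N₁ x + a * N₂ x) → ∀ z → conv N z ≈ conv N₁ z + a * conv N₂ z
  conv-+* {N} {N₁} {N₂} {a} eq z = begin
    ∑F (λ y → N (y + z) * B y)
      ≈⟨ ∑F-cong (λ y → trans (*-congʳ (eq (y + z)))
           (solve 4 (λ u a v b → (u :+ a :* v) :* b := u :* b :+ a :* (v :* b)) refl (N₁ (y + z)) a (N₂ (y + z)) (B y))) ⟩
    ∑F (λ y → N₁ (y + z) * B y + a * (N₂ (y + z) * B y))   ≈⟨ ∑F-+ _ _ ⟩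
    conv N₁ z + ∑F (λ y → a * (N₂ (y + z) * B y))          ≈⟨ +-congˡ (∑F-*ˡ a _) ⟩
    conv N₁ z + a * conv N₂ z                              ∎

  -- The inequality n ≤ j + 1 lets the recursion lower `n` while the target bound `j` stays fixed.
  conv-Below : ∀ {j n N} → Below n N → n ≤ suc j → j < k → Below j (conv N)
  conv-Below {j} (no-terms N≈0) _ _ = Below-0 j (λ z → ∑F-zero (λ y → trans (*-congʳ (N≈0 (y + z))) (zeroˡ _)))
  conv-Below (add-term a b N≈) (s≤s n≤j) j<k = Below-resp (conv-+* N≈)
    (Below-+ (conv-Below b (ℕₚ.m≤n⇒m≤1+n n≤j) j<k)
             (Below-*ˡ a (Below-≤ n≤j (conv-power-Below (ℕₚ.≤-<-trans n≤j j<k)))))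

  conv-Exact : ∀ {j N} → suc j < k → Exact (suc j) N → Exact j (conv N)
  conv-Exact {j} j+1<k (a , h , a≉0 , b , N≈) = Exact-resp (λ z → trans (conv-+* N≈ z) (+-comm _ _))
    (Exact-+ˡ (Exact-*ˡ a≉0 (conv-power-Exact j+1<k)) (conv-Below b ℕₚ.≤-refl (ℕₚ.<-trans (ℕₚ.n<1+n j) j+1<k)))

  B-Exact : Exact (ℕ.pred k) B
  B-Exact = Exact-sum {r = k} (λ i z → (z ^ m) ^ toℕ i) i₀
    (≡.subst (λ j → Exact (ℕ.pred k) (λ z → (z ^ m) ^ j)) (≡.sym (Finₚ.toℕ-fromℕ< pred<k)) (Exact-φ^ (ℕ.pred k)))
    (λ i i≢i₀ → Below-φ^ (ℕₚ.≤∧≢⇒< (ℕₚ.<⇒≤pred (Finₚ.toℕ<n i))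
      (λ eq → i≢i₀ (Finₚ.toℕ-injective (≡.trans eq (≡.sym (Finₚ.toℕ-fromℕ< pred<k)))))))
    where
    i₀ : Fin k
    i₀ = fromℕ< pred<k

  -- `B` has degree k - 1, so `i` convolutions lead to degree k - 1 - i. Any property `P` inherited
  -- by convolution is carried along; it is used once for invariance and once for walks.
  kernel-of-degree : ∀ {r} (P : (Carrier → Carrier) → Set r) → P B → (∀ N → P N → P (conv N)) →
                     ∀ i {j} → i +ℕ j ≡ ℕ.pred k → ∃ λ N → Exact j N × P N
  kernel-of-degree P PB P-conv zero    ≡.refl = B , B-Exact , PB
  kernel-of-degree P PB P-conv (suc i) {j} eq with N , ex , PN ← kernel-of-degree P PB P-conv i (≡.trans (ℕₚ.+-suc i j) eq) =
    conv N , conv-Exact (ℕₚ.≤-<-trans (≡.subst (suc j ≤_) (≡.trans (ℕₚ.+-suc i j) eq) (ℕₚ.m≤n+m (suc j) i)) pred<k) ex , P-conv N PN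

-- Automorphisms preserve (x - y)^m.

module ClassPreservation {c ℓ : Level} (F : CommutativeRing c ℓ) (isField : IsField F) {k e R : ℕ} (p-prime : Prime (suc (k *ℕ e)))
                         (size : HasSize F (suc (k *ℕ e) ^ℕ R)) (2≤k : 2 ≤ k)
                         (ω : CommutativeRing.Carrier F) (generates : IsPrimitive F ω) where
  open ConnectionSet F isField {k} {e} {R} p-prime size 2≤k ω generates public
  open GPaley F ω k public

  x-y≈0⇒x≈y : ∀ {x y} → x - y ≈ 0# → x ≈ y
  x-y≈0⇒x≈y {x} {y} = x∙y⁻¹≈ε⇒x≈y x y

  x≈y⇒x-y≈0 : ∀ {x y} → x ≈ y → x - y ≈ 0#
  x≈y⇒x-y≈0 {x} {y} x≈y = trans (+-congʳ x≈y) (-‿inverseʳ y)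

  +-‿cong : ∀ {x x′ y y′} → x ≈ x′ → y ≈ y′ → x - y ≈ x′ - y′
  +-‿cong x≈x′ y≈y′ = +-cong x≈x′ (-‿cong y≈y′)

  [x-y]+[y-z]≈x-z : ∀ x y z → (x - y) + (y - z) ≈ x - z
  [x-y]+[y-z]≈x-z x y z = trans (sym (+-assoc (x - y) y (- z))) (+-congʳ ([x-y]+y≈x x y))

  record Bijection (f : Carrier → Carrier) : Set (c ⊔ ℓ) where
    field
      f-cong   : Congruent F f
      f⁻¹      : Carrier → Carrier
      f⁻¹-cong : Congruent F f⁻¹
      f⁻¹∘f    : ∀ x → f⁻¹ (f x) ≈ x
      f∘f⁻¹    : ∀ x → f (f⁻¹ x) ≈ x

    f-injective : ∀ {x y} → f x ≈ f y → x ≈ y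
    f-injective {x} {y} eq = trans (sym (f⁻¹∘f x)) (trans (f⁻¹-cong _ _ eq) (f⁻¹∘f y))

  id-bijection : Bijection (λ x → x)
  id-bijection = record
    { f-cong = λ _ _ eq → eq ; f⁻¹ = λ x → x ; f⁻¹-cong = λ _ _ eq → eq ; f⁻¹∘f = λ _ → refl ; f∘f⁻¹ = λ _ → refl }

  -- Turns a sum over differences into a sum over vertices v. It is applied to an automorphism and
  -- to the identity, so that the two sums can be compared term by term.
  ∑F-differences : ∀ {f G} → Bijection f → Congruent F G → ∀ x → ∑F G ≈ ∑F (λ v → G (f v - f x))
  ∑F-differences {f} {G} f-bij G-cong x = ∑F-reindex {π = λ v → f v - f x} {ρ = λ w → f⁻¹ (w + f x)} {g = G}
    (λ _ _ eq → +-congʳ (f-cong _ _ eq))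
    (λ _ _ eq → f⁻¹-cong _ _ (+-congʳ eq))
    (λ w → trans (+-congʳ (f∘f⁻¹ (w + f x))) ([x+y]-y≈x w (f x)))
    (λ v → trans (f⁻¹-cong _ _ ([x-y]+y≈x (f v) (f x))) (f⁻¹∘f v))
    G-cong
    where open Bijection f-bij

  module _ {f : Carrier → Carrier} (f-bij : Bijection f)
           (f-S : ∀ x y → ((x - y) ^ m ≈ 1# → (f x - f y) ^ m ≈ 1#) × ((f x - f y) ^ m ≈ 1# → (x - y) ^ m ≈ 1#)) where
    open Bijection f-bij

    Invariant : (Carrier → Carrier) → Set (c ⊔ ℓ)
    Invariant N = Congruent F N × (∀ x y → N (f x - f y) ≈ N (x - y))

    B-Invariant : Invariant B
    B-Invariant = (λ _ _ eq → B-cong (^-congˡ m eq)) , λ x y → go x y (x ≟ y) ((x - y) ^ m ≟ 1#)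
      where
      go : ∀ x y → Dec (x ≈ y) → Dec ((x - y) ^ m ≈ 1#) → B (f x - f y) ≈ B (x - y)
      go x y (yes x≈y) _ = B-cong (^-congˡ m (trans (x≈y⇒x-y≈0 (f-cong x y x≈y)) (sym (x≈y⇒x-y≈0 x≈y))))
      go x y (no x≉y) (yes s) = B-cong (trans (proj₁ (f-S x y) s) (sym s))
      go x y (no x≉y) (no ¬s) = trans
        (B≈0 (λ eq → x≉y (f-injective (x-y≈0⇒x≈y eq))) (λ s → ¬s (proj₂ (f-S x y) s)))
        (sym (B≈0 (λ eq → x≉y (x-y≈0⇒x≈y eq)) ¬s))

    -- At f x - f y the convolution is the sum over v of N (f v - f y) B (f v - f x), and each
    -- factor is invariant.
    conv-Invariant : ∀ N → Invariant N → Invariant (conv N)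
    conv-Invariant N (N-cong , N-inv) =
      (λ z z′ eq → ∑F-cong (λ y → *-congʳ (N-cong _ _ (+-congˡ eq)))) , λ x y → begin
        ∑F (λ w → N (w + (f x - f y)) * B w)
          ≈⟨ ∑F-differences f-bij (summand-cong (f x - f y)) x ⟩
        ∑F (λ v → N ((f v - f x) + (f x - f y)) * B (f v - f x))
          ≈⟨ ∑F-cong (λ v → *-cong
               (begin
                 N ((f v - f x) + (f x - f y)) ≈⟨ N-cong _ _ ([x-y]+[y-z]≈x-z (f v) (f x) (f y)) ⟩
                 N (f v - f y)                 ≈⟨ N-inv v y ⟩
                 N (v - y)                     ≈⟨ N-cong _ _ ([x-y]+[y-z]≈x-z v x y) ⟨
                 N ((v - x) + (x - y))         ∎)
               (proj₂ B-Invariant v x)) ⟩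
        ∑F (λ v → N ((v - x) + (x - y)) * B (v - x))
          ≈⟨ ∑F-differences id-bijection (summand-cong (x - y)) x ⟨
        ∑F (λ w → N (w + (x - y)) * B w) ∎
      where
      summand-cong : ∀ z → Congruent F (λ w → N (w + z) * B w)
      summand-cong z _ _ eq = *-cong (N-cong _ _ (+-congʳ eq)) (proj₁ B-Invariant _ _ eq)

    -- After k - 2 convolutions the kernel has degree 1, say a z^m + b with a ≠ 0; its invariance is
    -- that of z^m.
    class-preserving : ∀ x y → (f x - f y) ^ m ≈ (x - y) ^ m
    class-preserving x y with kernel-of-degree Invariant B-Invariant conv-Invariant (ℕ.pred (ℕ.pred k)) {1}
        (≡.trans (ℕₚ.+-comm _ 1) (ℕₚ.suc-pred (ℕ.pred k) {{ℕ.>-nonZero (ℕ.s≤s⁻¹ (≡.subst (2 ≤_) (≡.sym suc-pred-k) 2≤k))}}))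
    ... | N , (a , h , a≉0 , Polynomials.add-term {h = h₀} b (Polynomials.no-terms h₀≈0) h≈ , N≈) , (_ , N-inv) =
      *-cancelˡ-≉0 a≉0 (+-cancelˡ (b * 1#) _ _ (begin
        b * 1# + a * (f x - f y) ^ m   ≈⟨ N-value (f x - f y) ⟨
        N (f x - f y)                  ≈⟨ N-inv x y ⟩
        N (x - y)                      ≈⟨ N-value (x - y) ⟩
        b * 1# + a * (x - y) ^ m       ∎))
      where
      N-value : ∀ z → N z ≈ b * 1# + a * z ^ m
      N-value z = begin
        N z                                  ≈⟨ N≈ z ⟩
        h z + a * (z ^ m * 1#)               ≈⟨ +-cong (h≈ z) (*-congˡ (*-identityʳ (z ^ m))) ⟩
        (h₀ z + b * 1#) + a * z ^ m          ≈⟨ +-congʳ (trans (+-congʳ (h₀≈0 z)) (+-identityˡ (b * 1#))) ⟩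
        b * 1# + a * z ^ m                   ∎

  -- Walks and connectedness.

  _◅◅_ : ∀ {u v w} → Walk u v → Walk v w → Walk u w
  here u≈v ◅◅ here v≈w = here (trans u≈v v≈w)
  here u≈v ◅◅ step {w = x} (j , eq) walk = step {w = x} (j , trans (+-congˡ (-‿cong u≈v)) eq) walk
  step adj walk ◅◅ walk′ = step adj (walk ◅◅ walk′)

  module _ (even : 2 ∣ m) where

    -- Symmetry of the connection set: `B` takes equal values at y and - y, so a step can be taken
    -- in either direction.
    ^m-even : ∀ x → (- x) ^ m ≈ x ^ m
    ^m-even x = begin
      (- x) ^ m              ≈⟨ halve (- x) ⟩
      ((- x) * - x) ^ h      ≈⟨ ^-congˡ h square ⟩
      (x * x) ^ h            ≈⟨ halve x ⟨
      x ^ m                  ∎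
      where
      h = quotient even
      square : (- x) * - x ≈ x * x
      square = begin
        (- x) * - x    ≈⟨ -‿distribˡ-* x (- x) ⟨
        - (x * - x)    ≈⟨ -‿cong (-‿distribʳ-* x x) ⟨
        - - (x * x)    ≈⟨ -‿involutive (x * x) ⟩
        x * x          ∎
      halve : ∀ y → y ^ m ≈ (y * y) ^ h
      halve y = begin
        y ^ m                 ≈⟨ ^-congʳ y (≡.trans (_∣_.equality even) (ℕₚ.*-comm h 2)) ⟩
        y ^ (2 *ℕ h)          ≈⟨ ^-assocʳ y 2 h ⟨
        (y * (y * 1#)) ^ h    ≈⟨ ^-congˡ h (*-congˡ (*-identityʳ y)) ⟩
        (y * y) ^ h           ∎

    -- Every difference in the support of `N` can be bridged by a walk, whatever its endpoints.
    Connecting : (Carrier → Carrier) → Set (c ⊔ ℓ)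
    Connecting N = ∀ z → ¬ N z ≈ 0# → ∀ u v → v - u ≈ z → Walk u v

    B-Connecting : Connecting B
    B-Connecting z Bz≉0 u v v-u≈z with B≉0⇒0⊎S Bz≉0
    ... | inj₁ z≈0   = here (sym (x-y≈0⇒x≈y (trans v-u≈z z≈0)))
    ... | inj₂ z^m≈1 = step {w = v} (^m≈1⇒Adj (trans (^-congˡ m v-u≈z) z^m≈1)) (here refl)

    -- A nonzero summand N (y + z) B y yields the intermediate vertex v + y: `N` joins u to it, and
    -- `B` at - y joins it to v.
    conv-Connecting : ∀ N → Connecting N → Connecting (conv N)
    conv-Connecting N N-conn z convz≉0 u v v-u≈z with y , Ny*By≉0 ← ∑F≉0⇒∃≉0 _ convz≉0 =
      N-conn (y + z) (*-≉0ˡ Ny*By≉0) u (v + y) (begin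
        (v + y) - u   ≈⟨ +-assoc v y (- u) ⟩
        v + (y - u)   ≈⟨ solve 3 (λ v y -u → v :+ (y :+ -u) := y :+ (v :+ -u)) refl v y (- u) ⟩
        y + (v - u)   ≈⟨ +-congˡ v-u≈z ⟩
        y + z         ∎)
      ◅◅ B-Connecting (- y) (λ eq → *-≉0ʳ Ny*By≉0 (trans (B-cong (sym (^m-even y))) eq)) (v + y) v (begin
        v - (v + y)         ≈⟨ +-congˡ (-‿+-comm v y) ⟨
        v + (- v - y)       ≈⟨ +-assoc v (- v) (- y) ⟨
        (v - v) - y         ≈⟨ +-congʳ (-‿inverseʳ v) ⟩
        0# - y              ≈⟨ +-identityˡ (- y) ⟩
        - y                 ∎)

    -- After k - 1 convolutions the kernel is a nonzero constant, so its support contains every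
    -- difference.
    connected : Connected
    connected u v with N , (a , h , a≉0 , Polynomials.no-terms h≈0 , N≈) , N-conn ← kernel-of-degree Connecting B-Connecting conv-Connecting
                         (ℕ.pred k) {0} (ℕₚ.+-identityʳ (ℕ.pred k)) =
      N-conn (v - u) (λ N≈0 → a≉0 (begin
        a                   ≈⟨ *-identityʳ a ⟨
        a * 1#              ≈⟨ +-identityˡ (a * 1#) ⟨
        0# + a * 1#         ≈⟨ +-congʳ (h≈0 (v - u)) ⟨
        h (v - u) + a * 1#  ≈⟨ N≈ (v - u) ⟨
        N (v - u)           ≈⟨ N≈0 ⟩
        0#                  ∎)) u v refl

-- A lower bound for sums of degrees.

repunit-+ : ∀ p s r → repunit p (s +ℕ r) ≡ repunit p s +ℕ p ^ℕ s *ℕ repunit p r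
repunit-+ p zero    r = ≡.sym (ℕₚ.+-identityʳ _)
repunit-+ p (suc s) r = ≡.cong suc (≡.trans (≡.cong (p *ℕ_) (repunit-+ p s r))
  (≡.trans (ℕₚ.*-distribˡ-+ p (repunit p s) _) (≡.cong (p *ℕ repunit p s +ℕ_) (≡.sym (ℕₚ.*-assoc p (p ^ℕ s) _)))))

repunit<^ : ∀ {d} → 0 < d → ∀ n → repunit (suc d) n < suc d ^ℕ n
repunit<^ {d} 0<d n = ≡.subst (repunit (suc d) n <_) (≡.sym (^≡1+*repunit d n))
  (s≤s (ℕₚ.m≤n*m (repunit (suc d) n) d {{ℕ.>-nonZero 0<d}}))

∑ℕ : (ℕ → ℕ) → ℕ → ℕ
∑ℕ δ zero    = 0
∑ℕ δ (suc n) = ∑ℕ δ n +ℕ δ n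

∑ℕ-mono-≤ : ∀ δ {m n} → m ≤ n → ∑ℕ δ m ≤ ∑ℕ δ n
∑ℕ-mono-≤ δ {m} m≤n = go (ℕₚ.≤⇒≤′ m≤n)
  where
  go : ∀ {n} → m ℕ.≤′ n → ∑ℕ δ m ≤ ∑ℕ δ n
  go (ℕ.≤′-reflexive ≡.refl) = ℕₚ.≤-refl
  go (ℕ.≤′-step m≤′n)        = ℕₚ.≤-trans (go m≤′n) (ℕₚ.m≤m+n _ _)

repunit*≤∑ℕ : ∀ p a δ n → (∀ l → l < n → p ^ℕ l *ℕ a ≤ δ l) → repunit p n *ℕ a ≤ ∑ℕ δ n
repunit*≤∑ℕ p a δ zero    δ≥ = z≤n
repunit*≤∑ℕ p a δ (suc n) δ≥ = begin
  repunit p (suc n) *ℕ a                    ≡⟨ ≡.cong (_*ℕ a) (repunit-suc p n) ⟩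
  (repunit p n +ℕ p ^ℕ n) *ℕ a              ≡⟨ ℕₚ.*-distribʳ-+ a (repunit p n) (p ^ℕ n) ⟩
  repunit p n *ℕ a +ℕ p ^ℕ n *ℕ a           ≤⟨ ℕₚ.+-mono-≤ (repunit*≤∑ℕ p a δ n (λ l l<n → δ≥ l (ℕₚ.m<n⇒m<1+n l<n))) (δ≥ n (ℕₚ.n<1+n n)) ⟩
  ∑ℕ δ n +ℕ δ n                             ∎
  where open ℕₚ.≤-Reasoning

first-crossing : ∀ (P : ℕ → Set) → (∀ n → Dec (P n)) → ∀ n →
                 (∀ l → l < n → P l) ⊎ (∃ λ r → r < n × ¬ P r × (∀ l → l < r → P l))
first-crossing P P? zero = inj₁ λ _ ()
first-crossing P P? (suc n) with first-crossing P P? n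
... | inj₂ (r , r<n , ¬Pr , P<r) = inj₂ (r , ℕₚ.m<n⇒m<1+n r<n , ¬Pr , P<r)
... | inj₁ P<n with P? n
...   | no ¬Pn = inj₂ (n , ℕₚ.n<1+n n , ¬Pn , P<n)
...   | yes Pn = inj₁ λ l l<1+n → [ P<n l , (λ { ≡.refl → Pn }) ]′ (ℕₚ.m≤n⇒m<n∨m≡n (ℕ.s≤s⁻¹ l<1+n))

-- If p^l a stays below p^R for all l < R, the sum is at least a times the repunit. Otherwise let r
-- be the first exception and s = R - r, so that p^s ≤ a. The terms up to r contribute at least a
-- (`repunit p r` + 1), which exceeds `repunit p s` + p^s `repunit p r`, the repunit of length R.
repunit<∑ℕ : ∀ {d R a} → 0 < d → 0 < R → 2 ≤ a → (δ : ℕ → ℕ) → (∀ l → l < R → a ≤ δ l) →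
             (∀ l → l < R → suc d ^ℕ l *ℕ a < suc d ^ℕ R → suc d ^ℕ l *ℕ a ≤ δ l) →
             repunit (suc d) R < ∑ℕ δ R
repunit<∑ℕ {d} {R} {a} 0<d 0<R 2≤a δ a≤δ p^l*a≤δ
  with first-crossing (λ l → suc d ^ℕ l *ℕ a < suc d ^ℕ R) (λ l → suc d ^ℕ l *ℕ a ℕ.<? suc d ^ℕ R) R
... | inj₁ small = begin-strict
  repunit p R              <⟨ ℕₚ.m<m*n (repunit p R) a {{ℕ.>-nonZero (0<repunit 0<R)}} 2≤a ⟩
  repunit p R *ℕ a         ≤⟨ repunit*≤∑ℕ p a δ R (λ l l<R → p^l*a≤δ l l<R (small l l<R)) ⟩
  ∑ℕ δ R                   ∎
  where
  open ℕₚ.≤-Reasoning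
  p = suc d
  0<repunit : ∀ {n} → 0 < n → 0 < repunit p n
  0<repunit (s≤s _) = s≤s z≤n
... | inj₂ (r , r<R , large , small) = begin-strict
  repunit p R                             ≡⟨ ≡.cong (repunit p) (≡.sym s+r≡R) ⟩
  repunit p (s +ℕ r)                      ≡⟨ repunit-+ p s r ⟩
  repunit p s +ℕ p ^ℕ s *ℕ repunit p r    <⟨ ℕₚ.+-monoˡ-< _ (repunit<^ 0<d s) ⟩
  p ^ℕ s +ℕ p ^ℕ s *ℕ repunit p r         ≤⟨ ℕₚ.+-mono-≤ p^s≤a (ℕₚ.*-monoˡ-≤ (repunit p r) p^s≤a) ⟩
  a +ℕ a *ℕ repunit p r                   ≡⟨ ≡.trans (ℕₚ.+-comm a _) (≡.cong (_+ℕ a) (ℕₚ.*-comm a (repunit p r))) ⟩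
  repunit p r *ℕ a +ℕ a                   ≤⟨ ℕₚ.+-mono-≤
                                               (repunit*≤∑ℕ p a δ r (λ l l<r → p^l*a≤δ l (ℕₚ.<-trans l<r r<R) (small l l<r)))
                                               (a≤δ r r<R) ⟩
  ∑ℕ δ (suc r)                            ≤⟨ ∑ℕ-mono-≤ δ r<R ⟩
  ∑ℕ δ R                                  ∎
  where
  open ℕₚ.≤-Reasoning
  p = suc d
  s = R ∸ r
  s+r≡R : s +ℕ r ≡ R
  s+r≡R = ℕₚ.m∸n+n≡m (ℕₚ.<⇒≤ r<R)
  p^s≤a : p ^ℕ s ≤ a
  p^s≤a = ℕₚ.*-cancelˡ-≤ (p ^ℕ r) {{ℕₚ.m^n≢0 p r}} (ℕₚ.≤-trans
    (ℕₚ.≤-reflexive (≡.trans (≡.sym (ℕₚ.^-distribˡ-+-* p r s)) (≡.cong (p ^ℕ_) (≡.trans (ℕₚ.+-comm r s) s+r≡R))))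
    (ℕₚ.≮⇒≥ large))

-- Uniqueness of degrees up to q - 1, and degree bounds for powers of an automorphism.

module Rigidity {c ℓ : Level} (F : CommutativeRing c ℓ) (isField : IsField F) {k e R : ℕ} (p-prime : Prime (suc (k *ℕ e)))
                (size : HasSize F (suc (k *ℕ e) ^ℕ R)) (2≤k : 2 ≤ k)
                (ω : CommutativeRing.Carrier F) (generates : IsPrimitive F ω) where
  open ClassPreservation F isField {k} {e} {R} p-prime size 2≤k ω generates public
  open Polynomials F isField size id

  e<p : e < p
  e<p = s≤s (ℕₚ.m≤n*m e k {{ℕ.>-nonZero (ℕₚ.<-trans (s≤s z≤n) 2≤k)}})

  -- The lower entry has `n` digits `e`, then the digit `a`, then zeros. Each is at most the
  -- corresponding digit `e` of the upper entry, so every factor given by Lucas is nonzero.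
  bin-digits≉0 : ∀ {n r a} → n < r → a ≤ e → ¬ bin (e *ℕ repunit p r) (e *ℕ repunit p n +ℕ a *ℕ p ^ℕ n) ≈ 0#
  bin-digits≉0 {zero} {suc r} {a} _ a≤e eq =
    *-≉0 (λ eq′ → 1≉0 (trans (sym (bin-0 (e *ℕ M))) eq′)) (bin-digit≉0 a≤e e<p) (begin
      bin (e *ℕ M) 0 * bin e a                   ≈⟨ lucas (e *ℕ M) 0 e<p (ℕₚ.≤-<-trans a≤e e<p) ⟨
      bin (e +ℕ e *ℕ M *ℕ p) (a +ℕ 0)            ≈⟨ ι-cong (≡.cong₂ _C_ (≡.sym (*-repunit-suc p e M))
                                                      (≡.trans (ℕₚ.+-identityʳ a) (≡.sym (≡.cong₂ _+ℕ_ (ℕₚ.*-zeroʳ e) (ℕₚ.*-identityʳ a))))) ⟩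
      bin (e *ℕ suc (p *ℕ M)) (e *ℕ 0 +ℕ a *ℕ 1) ≈⟨ eq ⟩
      0#                                         ∎)
    where M = repunit p r
  bin-digits≉0 {suc n} {suc r} {a} (s≤s n<r) a≤e eq =
    *-≉0 (bin-digits≉0 n<r a≤e) (bin-digit≉0 ℕₚ.≤-refl e<p) (begin
      bin (e *ℕ M) t * bin e e                   ≈⟨ lucas (e *ℕ M) t e<p e<p ⟨
      bin (e +ℕ e *ℕ M *ℕ p) (e +ℕ t *ℕ p)       ≈⟨ ι-cong (≡.cong₂ _C_ (≡.sym (*-repunit-suc p e M)) t-digits) ⟩
      bin (e *ℕ suc (p *ℕ M)) (e *ℕ suc (p *ℕ repunit p n) +ℕ a *ℕ p ^ℕ suc n) ≈⟨ eq ⟩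
      0#                                         ∎)
    where
    M = repunit p r
    t = e *ℕ repunit p n +ℕ a *ℕ p ^ℕ n
    t-digits : e +ℕ t *ℕ p ≡ e *ℕ suc (p *ℕ repunit p n) +ℕ a *ℕ p ^ℕ suc n
    t-digits = ≡.trans (≡.cong (e +ℕ_) (ℕₚ.*-distribʳ-+ p (e *ℕ repunit p n) (a *ℕ p ^ℕ n)))
      (≡.trans (≡.sym (ℕₚ.+-assoc e _ _)) (≡.cong₂ _+ℕ_ (≡.sym (*-repunit-suc p e (repunit p n)))
        (≡.trans (ℕₚ.*-assoc a (p ^ℕ n) p) (≡.cong (a *ℕ_) (ℕₚ.*-comm (p ^ℕ n) p)))))

  m+m≤Q : m +ℕ m ≤ Q
  m+m≤Q = ≡.subst (m +ℕ m ≤_) (≡.sym Q≡k*m) (≡.subst (_≤ k *ℕ m) (≡.cong (m +ℕ_) (ℕₚ.+-identityʳ m)) (ℕₚ.*-monoˡ-≤ m 2≤k))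

  m≤Q : m ≤ Q
  m≤Q = ℕₚ.≤-trans (ℕₚ.m≤m+n m m) m+m≤Q

  -- For d ≤ Q, the functional g ↦ ∑ g(y) y^(Q-d) is minus the coefficient of degree d
  -- on polynomials of degree at most d.
  coefficient : ℕ → (Carrier → Carrier) → Carrier
  coefficient d g = ∑F (λ y → g y * y ^ (Q ∸ d))

  coefficient-+* : ∀ {d n g h a} → (∀ x → g x ≈ h x + a * x ^ n) →
                   coefficient d g ≈ coefficient d h + a * ∑F (_^ (n +ℕ (Q ∸ d)))
  coefficient-+* {d} {n} {g} {h} {a} g≈ = begin
    ∑F (λ y → g y * y ^ (Q ∸ d))
      ≈⟨ ∑F-cong (λ y → trans (*-congʳ (g≈ y))
           (solve 4 (λ u a v w → (u :+ a :* v) :* w := u :* w :+ a :* (v :* w)) refl (h y) a (y ^ n) (y ^ (Q ∸ d)))) ⟩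
    ∑F (λ y → h y * y ^ (Q ∸ d) + a * (y ^ n * y ^ (Q ∸ d)))
      ≈⟨ ∑F-+ _ _ ⟩
    coefficient d h + ∑F (λ y → a * (y ^ n * y ^ (Q ∸ d)))
      ≈⟨ +-congˡ (∑F-*ˡ a _) ⟩
    coefficient d h + a * ∑F (λ y → y ^ n * y ^ (Q ∸ d))
      ≈⟨ +-congˡ (*-congˡ (∑F-cong (λ y → ^-homo-* y n (Q ∸ d)))) ⟨
    coefficient d h + a * ∑F (_^ (n +ℕ (Q ∸ d))) ∎

  coefficient-Below : ∀ {d n g} → Below n g → n ≤ d → d ≤ Q → coefficient d g ≈ 0#
  coefficient-Below (no-terms g≈0) _ _ = ∑F-zero (λ y → trans (*-congʳ (g≈0 y)) (zeroˡ _))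
  coefficient-Below {d} {suc n} (add-term {h = h} a b g≈) n<d d≤Q = begin
    _                                              ≈⟨ coefficient-+* {d} {n} {h = h} g≈ ⟩
    coefficient d h + a * ∑F (_^ (n +ℕ (Q ∸ d)))   ≈⟨ +-cong (coefficient-Below b (ℕₚ.<⇒≤ n<d) d≤Q)
                                                        (*-congˡ (∑F-^≈0 (ℕₚ.<-≤-trans n+Q∸d<Q (ℕₚ.m≤m+n Q Q)) (ℕₚ.<⇒≢ n+Q∸d<Q))) ⟩
    0# + a * 0#                                    ≈⟨ trans (+-identityˡ _) (zeroʳ a) ⟩
    0#                                             ∎
    where
    n+Q∸d<Q : n +ℕ (Q ∸ d) < Q
    n+Q∸d<Q = ≡.subst (n +ℕ (Q ∸ d) <_) (ℕₚ.m+[n∸m]≡n d≤Q) (ℕₚ.+-monoˡ-< (Q ∸ d) n<d)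

  -- For d ≤ Q, `coefficient d` kills degrees below `d` but not degree `d`, so a function of exact
  -- degree `d` has no representation of lower degree.
  Exact∧Below⇒< : ∀ {d n g} → Exact d g → Below n g → d ≤ Q → d < n
  Exact∧Below⇒< {d} {n} {g} (a , h , a≉0 , b , g≈) b′ d≤Q with n ℕ.≤? d
  ... | no n≰d  = ℕₚ.≰⇒> n≰d
  ... | yes n≤d = ⊥-elim (*-≉0 a≉0 (-‿≉0 1≉0) (begin
    a * - 1#                                       ≈⟨ *-congˡ ∑F-^Q≈-1 ⟨
    a * ∑F (_^ Q)                                  ≈⟨ *-congˡ (reflexive (≡.cong (λ b → ∑F (_^ b)) (ℕₚ.m+[n∸m]≡n d≤Q))) ⟨
    a * ∑F (_^ (d +ℕ (Q ∸ d)))                     ≈⟨ +-identityˡ _ ⟨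
    0# + a * ∑F (_^ (d +ℕ (Q ∸ d)))                ≈⟨ +-congʳ (coefficient-Below b ℕₚ.≤-refl d≤Q) ⟨
    coefficient d h + a * ∑F (_^ (d +ℕ (Q ∸ d)))   ≈⟨ coefficient-+* {d} {d} {h = h} g≈ ⟨
    coefficient d g                                ≈⟨ coefficient-Below b′ n≤d d≤Q ⟩
    0#                                             ∎))

  Exact-unique : ∀ {d d′ g} → Exact d g → Exact d′ g → d ≤ Q → d′ ≤ Q → d ≡ d′
  Exact-unique ex ex′ d≤Q d′≤Q = ℕₚ.≤-antisym
    (ℕ.s≤s⁻¹ (Exact∧Below⇒< ex (Exact⇒Below ex′) d≤Q))
    (ℕ.s≤s⁻¹ (Exact∧Below⇒< ex′ (Exact⇒Below ex) d′≤Q))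

  Below-[x-v]^ : ∀ v n → Below (suc n) (λ x → (x - v) ^ n)
  Below-[x-v]^ v zero    = Below-φ^ (s≤s z≤n)
  Below-[x-v]^ v (suc n) = Below-resp (λ x → distribʳ ((x - v) ^ n) x (- v))
    (Below-+ (Below-φ* (Below-[x-v]^ v n)) (Below-suc (Below-*ˡ (- v) (Below-[x-v]^ v n))))

  record Normalised (f : Carrier → Carrier) : Set (c ⊔ ℓ) where
    field
      bijection : Bijection f
      f0≈0      : f 0# ≈ 0#
      f1≈1      : f 1# ≈ 1#
      class     : ∀ x y → (f x - f y) ^ m ≈ (x - y) ^ m

    open Bijection bijection public

  -- By the binomial theorem ∑ (y + f x)^m y^c is a multiple of f(x)^t for a suitable c;
  -- the substitution y = - f v turns it into a combination of the polynomials (x - v)^m.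
  power-Below : ∀ {f t} → Normalised f → t ≤ m → ¬ bin m t ≈ 0# → Below (suc m) (λ x → f x ^ t)
  power-Below {f} {t} f-norm t≤m bin≉0 with a⁻¹ , inv ← proj₂ isField (bin m t) bin≉0 =
    Below-resp f^t≈ (Below-*ˡ (- a⁻¹) (Below-∑F _ (λ v → Below-*ˡ ((- f v) ^ c′) (Below-[x-v]^ v m))))
    where
    open Normalised f-norm
    m∸t≤Q : m ∸ t ≤ Q
    m∸t≤Q = ℕₚ.≤-trans (ℕₚ.m∸n≤m m t) m≤Q
    c′ : ℕ
    c′ = Q ∸ (m ∸ t)
    m<Q : m < Q
    m<Q = ℕₚ.<-≤-trans (≡.subst (_< m +ℕ m) (ℕₚ.+-identityʳ m) (ℕₚ.+-monoʳ-< m 0<m)) m+m≤Q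
    kernel≈ : ∀ x → ∑F (λ v → (- f v) ^ c′ * (x - v) ^ m) ≈ - (bin m t * f x ^ t)
    kernel≈ x = begin
      ∑F (λ v → (- f v) ^ c′ * (x - v) ^ m)
        ≈⟨ ∑F-cong (λ v → trans (*-comm _ _) (*-congʳ (begin
             (x - v) ^ m          ≈⟨ class x v ⟨
             (f x - f v) ^ m      ≈⟨ ^-congˡ m (+-comm (f x) (- f v)) ⟩
             (- f v + f x) ^ m    ∎))) ⟩
      ∑F (λ v → (- f v + f x) ^ m * (- f v) ^ c′)
        ≈⟨ ∑F-reindex {π = λ v → - f v} {ρ = λ y → f⁻¹ (- y)} {g = λ y → (y + f x) ^ m * y ^ c′}
             (λ _ _ eq → -‿cong (f-cong _ _ eq)) (λ _ _ eq → f⁻¹-cong _ _ (-‿cong eq))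
             (λ y → trans (-‿cong (f∘f⁻¹ (- y))) (-‿involutive y))
             (λ v → trans (f⁻¹-cong _ _ (-‿involutive (f v))) (f⁻¹∘f v))
             (λ _ _ eq → *-cong (^-congˡ m (+-congʳ eq)) (^-congˡ c′ eq)) ⟨
      ∑F (λ y → (y + f x) ^ m * y ^ c′)
        ≈⟨ ∑F-binomial (f x) (ℕₚ.+-mono-<-≤ m<Q (ℕₚ.m∸n≤m Q (m ∸ t))) (ℕₚ.m∸n≤m Q (m ∸ t)) ⟩
      - (bin m (Q ∸ c′) * f x ^ (m ∸ (Q ∸ c′)))
        ≈⟨ reflexive (≡.cong (λ r → - (bin m r * f x ^ (m ∸ r))) (ℕₚ.m∸[m∸n]≡n m∸t≤Q)) ⟩
      - (bin m (m ∸ t) * f x ^ (m ∸ (m ∸ t)))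
        ≈⟨ -‿cong (*-cong (ι-cong (≡.sym (nCk≡nC[n∸k] t≤m))) (^-congʳ (f x) (ℕₚ.m∸[m∸n]≡n t≤m))) ⟩
      - (bin m t * f x ^ t) ∎
    f^t≈ : ∀ x → f x ^ t ≈ - a⁻¹ * ∑F (λ v → (- f v) ^ c′ * (x - v) ^ m)
    f^t≈ x = sym (begin
      - a⁻¹ * ∑F (λ v → (- f v) ^ c′ * (x - v) ^ m)  ≈⟨ *-congˡ (kernel≈ x) ⟩
      - a⁻¹ * - (bin m t * f x ^ t)                  ≈⟨ -‿distribˡ-* a⁻¹ _ ⟨
      - (a⁻¹ * - (bin m t * f x ^ t))                ≈⟨ -‿cong (-‿distribʳ-* a⁻¹ _) ⟨
      - - (a⁻¹ * (bin m t * f x ^ t))                ≈⟨ -‿involutive _ ⟩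
      a⁻¹ * (bin m t * f x ^ t)                      ≈⟨ solve 3 (λ i b y → i :* (b :* y) := (b :* i) :* y) refl a⁻¹ (bin m t) (f x ^ t) ⟩
      (bin m t * a⁻¹) * f x ^ t                      ≈⟨ *-congʳ inv ⟩
      1# * f x ^ t                                   ≈⟨ *-identityˡ _ ⟩
      f x ^ t                                        ∎)

-- Normalised automorphisms are inverses of Frobenius powers.

module FrobeniusRigidity {c ℓ : Level} (F : CommutativeRing c ℓ) (isField : IsField F) {k e R : ℕ} (p-prime : Prime (suc (k *ℕ e)))
            (size : HasSize F (suc (k *ℕ e) ^ℕ R)) (2≤k : 2 ≤ k)
            (ω : CommutativeRing.Carrier F) (generates : IsPrimitive F ω) where
  open Rigidity F isField {k} {e} {R} p-prime size 2≤k ω generates public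
  open Polynomials F isField size id

  0<R : 0 < R
  0<R = ℕₚ.n≢0⇒n>0 λ R≡0 → ℕₚ.<-irrefl (≡.sym (≡.trans m≡e*repunit
    (≡.trans (≡.cong (λ r → e *ℕ repunit p r) R≡0) (ℕₚ.*-zeroʳ e)))) 0<m

  ^p^-suc : ∀ x l → x ^ (p ^ℕ suc l) ≈ (x ^ p) ^ (p ^ℕ l)
  ^p^-suc x l = sym (^-assocʳ x p (p ^ℕ l))

  ^p^-+ : ∀ x l s → x ^ (p ^ℕ (l +ℕ s)) ≈ (x ^ (p ^ℕ l)) ^ (p ^ℕ s)
  ^p^-+ x l s = trans (^-congʳ x (ℕₚ.^-distribˡ-+-* p l s)) (sym (^-assocʳ x (p ^ℕ l) (p ^ℕ s)))

  frobenius-iterate-- : ∀ l x y → (x - y) ^ (p ^ℕ l) ≈ x ^ (p ^ℕ l) - y ^ (p ^ℕ l)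
  frobenius-iterate-- zero    x y = trans (*-identityʳ _) (sym (+-‿cong (*-identityʳ x) (*-identityʳ y)))
  frobenius-iterate-- (suc l) x y = begin
    (x - y) ^ (p ^ℕ suc l)                     ≈⟨ ^p^-suc (x - y) l ⟩
    ((x - y) ^ p) ^ (p ^ℕ l)                   ≈⟨ ^-congˡ (p ^ℕ l) (frobenius-- x y) ⟩
    (x ^ p - y ^ p) ^ (p ^ℕ l)                 ≈⟨ frobenius-iterate-- l (x ^ p) (y ^ p) ⟩
    (x ^ p) ^ (p ^ℕ l) - (y ^ p) ^ (p ^ℕ l)    ≈⟨ +-‿cong (^p^-suc x l) (^p^-suc y l) ⟨
    x ^ (p ^ℕ suc l) - y ^ (p ^ℕ suc l)        ∎

  -- k divides p - 1, so the values z^m lie in the prime field.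
  [z^p]^m≈z^m : ∀ z → (z ^ p) ^ m ≈ z ^ m
  [z^p]^m≈z^m z with z ≟ 0#
  ... | yes z≈0 = trans (0^n≈0 0<m (0^n≈0 {z} {p} (s≤s z≤n) z≈0)) (sym (0^n≈0 0<m z≈0))
  ... | no z≉0  = begin
    (z ^ p) ^ m                      ≈⟨ ^-swap z p m ⟩
    z ^ m * (z ^ m) ^ (k *ℕ e)       ≈⟨ *-congˡ (^-assocʳ (z ^ m) k e) ⟨
    z ^ m * ((z ^ m) ^ k) ^ e        ≈⟨ *-congˡ (^-congˡ e (begin
      (z ^ m) ^ k                      ≈⟨ ^-swap z m k ⟩
      (z ^ k) ^ m                      ≈⟨ ^-assocʳ z k m ⟩
      z ^ (k *ℕ m)                     ≈⟨ ^-congʳ z Q≡k*m ⟨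
      z ^ Q                            ≈⟨ fermat z≉0 ⟩
      1#                               ∎)) ⟩
    z ^ m * 1# ^ e                   ≈⟨ *-congˡ (1^n≈1 e) ⟩
    z ^ m * 1#                       ≈⟨ *-identityʳ _ ⟩
    z ^ m                            ∎

  [z^p^l]^m≈z^m : ∀ l z → (z ^ (p ^ℕ l)) ^ m ≈ z ^ m
  [z^p^l]^m≈z^m zero    z = ^-congˡ m (*-identityʳ z)
  [z^p^l]^m≈z^m (suc l) z = begin
    (z ^ (p ^ℕ suc l)) ^ m       ≈⟨ ^-congˡ m (^p^-suc z l) ⟩
    ((z ^ p) ^ (p ^ℕ l)) ^ m     ≈⟨ [z^p^l]^m≈z^m l (z ^ p) ⟩
    (z ^ p) ^ m                  ≈⟨ [z^p]^m≈z^m z ⟩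
    z ^ m                        ∎

  fermat-iterate : ∀ l x → x ^ ((p ^ℕ R) ^ℕ l) ≈ x
  fermat-iterate zero    x = *-identityʳ x
  fermat-iterate (suc l) x = begin
    x ^ (p ^ℕ R *ℕ (p ^ℕ R) ^ℕ l)      ≈⟨ ^-assocʳ x (p ^ℕ R) ((p ^ℕ R) ^ℕ l) ⟨
    (x ^ (p ^ℕ R)) ^ ((p ^ℕ R) ^ℕ l)   ≈⟨ fermat-iterate l (x ^ (p ^ℕ R)) ⟩
    x ^ (p ^ℕ R)                       ≈⟨ fermat′ x ⟩
    x                                  ∎

  ^p^l-bijection : ∀ l → Bijection (_^ (p ^ℕ l))
  ^p^l-bijection l = record
    { f-cong   = λ _ _ → ^-congˡ (p ^ℕ l)
    ; f⁻¹      = _^ (p ^ℕ l′)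
    ; f⁻¹-cong = λ _ _ → ^-congˡ (p ^ℕ l′)
    ; f⁻¹∘f    = inv
    ; f∘f⁻¹    = λ x → trans (^-swap x (p ^ℕ l′) (p ^ℕ l)) (inv x)
    }
    where
    -- The exponents then add up to R l, and p^(R l) = q^l acts as the identity; R ≥ 1 makes the
    -- subtraction exact.
    l′ = R *ℕ l ∸ l
    inv : ∀ x → (x ^ (p ^ℕ l)) ^ (p ^ℕ l′) ≈ x
    inv x = begin
      (x ^ (p ^ℕ l)) ^ (p ^ℕ l′)    ≈⟨ ^p^-+ x l l′ ⟨
      x ^ (p ^ℕ (l +ℕ l′))          ≈⟨ ^-congʳ x (≡.trans (≡.cong (p ^ℕ_) (ℕₚ.m+[n∸m]≡n (ℕₚ.m≤n*m l R {{ℕ.>-nonZero 0<R}})))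
                                         (≡.sym (ℕₚ.^-*-assoc p R l))) ⟩
      x ^ ((p ^ℕ R) ^ℕ l)           ≈⟨ fermat-iterate l x ⟩
      x                             ∎

  ∘-bijection : ∀ {f g} → Bijection f → Bijection g → Bijection (λ x → f (g x))
  ∘-bijection {f} {g} f-bij g-bij = record
    { f-cong   = λ _ _ eq → f.f-cong _ _ (g.f-cong _ _ eq)
    ; f⁻¹      = λ x → g.f⁻¹ (f.f⁻¹ x)
    ; f⁻¹-cong = λ _ _ eq → g.f⁻¹-cong _ _ (f.f⁻¹-cong _ _ eq)
    ; f⁻¹∘f    = λ x → trans (g.f⁻¹-cong _ _ (f.f⁻¹∘f (g x))) (g.f⁻¹∘f x)
    ; f∘f⁻¹    = λ x → trans (f.f-cong _ _ (g.f∘f⁻¹ (f.f⁻¹ x))) (f.f∘f⁻¹ x)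
    }
    where
    module f = Bijection f-bij
    module g = Bijection g-bij

  -- Frobenius is additive and does not change m-th powers, so composing with its iterates keeps `f`
  -- normalised and allows passing to an iterate of smaller degree.
  Normalised-^p^l : ∀ {f} → Normalised f → ∀ l → Normalised (λ x → f x ^ (p ^ℕ l))
  Normalised-^p^l {f} f-norm l = record
    { bijection = ∘-bijection (^p^l-bijection l) bijection
    ; f0≈0      = 0^n≈0 (ℕₚ.m^n>0 p l) f0≈0
    ; f1≈1      = trans (^-congˡ (p ^ℕ l) f1≈1) (1^n≈1 (p ^ℕ l))
    ; class     = λ x y → begin
        (f x ^ (p ^ℕ l) - f y ^ (p ^ℕ l)) ^ m   ≈⟨ ^-congˡ m (frobenius-iterate-- l (f x) (f y)) ⟨
        ((f x - f y) ^ (p ^ℕ l)) ^ m            ≈⟨ [z^p^l]^m≈z^m l (f x - f y) ⟩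
        (f x - f y) ^ m                         ≈⟨ class x y ⟩
        (x - y) ^ m                             ∎
    }
    where open Normalised f-norm

  bin-m≉0 : ∀ {n a} → n < R → a ≤ e → ¬ bin m (e *ℕ repunit p n +ℕ a *ℕ p ^ℕ n) ≈ 0#
  bin-m≉0 {n} {a} n<R a≤e eq = bin-digits≉0 n<R a≤e
    (trans (ι-cong (≡.cong (_C (e *ℕ repunit p n +ℕ a *ℕ p ^ℕ n)) (≡.sym m≡e*repunit))) eq)

  -- Read off from the binomial coefficient: C(m, t) would be 0 for t > m.
  digits≤m : ∀ {n a} → n < R → a ≤ e → e *ℕ repunit p n +ℕ a *ℕ p ^ℕ n ≤ m
  digits≤m {n} {a} n<R a≤e with e *ℕ repunit p n +ℕ a *ℕ p ^ℕ n ℕ.≤? m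
  ... | yes t≤m = t≤m
  ... | no t≰m  = ⊥-elim (bin-m≉0 n<R a≤e (bin-> (ℕₚ.≰⇒> t≰m)))

  -- The exponent 1 is the digit pattern with n = 0 and a = 1.
  Normalised-Below : ∀ {f} → Normalised f → Below (suc m) f
  Normalised-Below {f} f-norm = Below-resp (λ x → sym (*-identityʳ (f x)))
    (power-Below {t = 1} f-norm (≡.subst (_≤ m) digits≡1 (digits≤m 0<R 0<e))
      (λ eq → bin-m≉0 0<R 0<e (trans (ι-cong (≡.cong (m C_) digits≡1)) eq)))
    where
    digits≡1 : e *ℕ 0 +ℕ 1 ≡ 1
    digits≡1 = ≡.cong (_+ℕ 1) (ℕₚ.*-zeroʳ e)

  ¬Exact-0 : ∀ {f} → Normalised f → ¬ Exact 0 f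
  ¬Exact-0 {f} f-norm (a , h , _ , no-terms h≈0 , f≈) = 1≉0 (begin
    1#                ≈⟨ f1≈1 ⟨
    f 1#              ≈⟨ constant 1# ⟩
    0# + a * 1#       ≈⟨ constant 0# ⟨
    f 0#              ≈⟨ f0≈0 ⟩
    0#                ∎)
    where
    open Normalised f-norm
    constant : ∀ x → f x ≈ 0# + a * 1#
    constant x = begin
      f x             ≈⟨ f≈ x ⟩
      h x + a * 1#    ≈⟨ +-congʳ (h≈0 x) ⟩
      0# + a * 1#     ∎

  opaque
    degree : ∀ {f} → Normalised f → ∃ λ d → 1 ≤ d × d ≤ m × Exact d f
    degree {f} f-norm = [ (λ f≈0 → ⊥-elim (1≉0 (trans (sym f1≈1) (f≈0 1#)))) , positive ]′
                          (zero⊎Exact (Normalised-Below f-norm))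
      where
      open Normalised f-norm
      positive : (∃ λ d → d < suc m × Exact d f) → ∃ λ d → 1 ≤ d × d ≤ m × Exact d f
      positive (zero  , _       , ex) = ⊥-elim (¬Exact-0 f-norm ex)
      positive (suc d , s≤s d<m , ex) = suc d , s≤s z≤n , d<m , ex

  module _ {f : Carrier → Carrier} (f-norm : Normalised f) where

    δ : ℕ → ℕ
    δ l = proj₁ (degree (Normalised-^p^l f-norm l))

    1≤δ : ∀ l → 1 ≤ δ l
    1≤δ l = proj₁ (proj₂ (degree (Normalised-^p^l f-norm l)))

    δ≤m : ∀ l → δ l ≤ m
    δ≤m l = proj₁ (proj₂ (proj₂ (degree (Normalised-^p^l f-norm l))))

    δ-Exact : ∀ l → Exact (δ l) (λ x → f x ^ (p ^ℕ l))
    δ-Exact l = proj₂ (proj₂ (proj₂ (degree (Normalised-^p^l f-norm l))))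

    DegreeBound : ℕ → ℕ → Set (c ⊔ ℓ)
    DegreeBound d t = Exact d (λ x → f x ^ t) × d ≤ m

    -- No reduction modulo x^q - x takes place when one factor f^(p^n) is added, since
    -- both degrees are at most m ≤ Q / 2.
    add-digit : ∀ {n d} → n < R → DegreeBound d (e *ℕ repunit p n) →
                ∀ a → a ≤ e → DegreeBound (d +ℕ a *ℕ δ n) (e *ℕ repunit p n +ℕ a *ℕ p ^ℕ n)
    add-digit {n} {d} n<R (ex , d≤m) zero _ =
      ≡.subst₂ DegreeBound (≡.sym (ℕₚ.+-identityʳ d)) (≡.sym (ℕₚ.+-identityʳ (e *ℕ repunit p n))) (ex , d≤m)
    add-digit {n} {d} n<R bound (suc a) a<e =
      ex′ , ℕ.s≤s⁻¹ (Exact∧Below⇒< ex′ (power-Below f-norm (digits≤m n<R a<e) (bin-m≉0 n<R a<e))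
        (ℕₚ.≤-trans (≡.subst (_≤ m +ℕ m) (rotate d (a *ℕ δ n) (δ n)) (ℕₚ.+-mono-≤ (proj₂ previous) (δ≤m n))) m+m≤Q))
      where
      rotate : ∀ x y z → (x +ℕ y) +ℕ z ≡ x +ℕ (z +ℕ y)
      rotate x y z = ≡.trans (ℕₚ.+-assoc x y z) (≡.cong (x +ℕ_) (ℕₚ.+-comm y z))
      t = e *ℕ repunit p n +ℕ a *ℕ p ^ℕ n
      previous : DegreeBound (d +ℕ a *ℕ δ n) t
      previous = add-digit n<R bound a (ℕₚ.<⇒≤ a<e)
      ex′ : Exact (d +ℕ suc a *ℕ δ n) (λ x → f x ^ (e *ℕ repunit p n +ℕ suc a *ℕ p ^ℕ n))
      ex′ = Exact-resp
        (λ x → begin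
          f x ^ (e *ℕ repunit p n +ℕ suc a *ℕ p ^ℕ n)   ≈⟨ ^-congʳ (f x) (rotate (e *ℕ repunit p n) (a *ℕ p ^ℕ n) (p ^ℕ n)) ⟨
          f x ^ (t +ℕ p ^ℕ n)                           ≈⟨ ^-homo-* (f x) t (p ^ℕ n) ⟩
          f x ^ t * f x ^ (p ^ℕ n)                      ∎)
        (≡.subst (λ D → Exact D (λ x → f x ^ t * f x ^ (p ^ℕ n))) (rotate d (a *ℕ δ n) (δ n)) (Exact-* (proj₁ previous) (δ-Exact n)))

    -- Adds the digit `e` at each of the first `n` positions. At n = R the exponent is `m` itself,
    -- and the bound by `m` restricts the sum of all degrees.
    degree-repunit : ∀ n → n ≤ R → DegreeBound (e *ℕ ∑ℕ δ n) (e *ℕ repunit p n)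
    degree-repunit zero    _   = ≡.subst₂ DegreeBound (≡.sym (ℕₚ.*-zeroʳ e)) (≡.sym (ℕₚ.*-zeroʳ e)) (Exact-φ^ 0 , z≤n)
    degree-repunit (suc n) n<R = ≡.subst₂ DegreeBound
      (≡.sym (ℕₚ.*-distribˡ-+ e (∑ℕ δ n) (δ n)))
      (≡.trans (≡.sym (ℕₚ.*-distribˡ-+ e (repunit p n) (p ^ℕ n))) (≡.cong (e *ℕ_) (≡.sym (repunit-suc p n))))
      (add-digit n<R (degree-repunit n (ℕₚ.<⇒≤ n<R)) e ℕₚ.≤-refl)

    ∑δ≤repunit : ∑ℕ δ R ≤ repunit p R
    ∑δ≤repunit = ℕₚ.*-cancelˡ-≤ e {{ℕ.>-nonZero 0<e}}
      (≡.subst (e *ℕ ∑ℕ δ R ≤_) m≡e*repunit (proj₂ (degree-repunit R ℕₚ.≤-refl)))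

    -- As long as p^l d < q, the power f^(p^l) has degree exactly p^l d by uniqueness. With d ≥ 2
    -- the sum of the degrees would then exceed `repunit p R`, against `∑δ≤repunit`.
    minimal-degree≡1 : ∀ {d} → 1 ≤ d → d ≤ m → Exact d f → (∀ l → l < R → d ≤ δ l) → d ≡ 1
    minimal-degree≡1 {d} 1≤d d≤m ex d≤δ with 2 ℕ.≤? d
    ... | no 2≰d  = ℕₚ.≤-antisym (ℕ.s≤s⁻¹ (ℕₚ.≰⇒> 2≰d)) 1≤d
    ... | yes 2≤d = ⊥-elim (ℕₚ.<⇒≱ (repunit<∑ℕ {k *ℕ e} {R} 0<ke 0<R 2≤d δ d≤δ p^l*d≤δ) ∑δ≤repunit)
      where
      0<ke : 0 < k *ℕ e
      0<ke = ℕₚ.<-trans (s≤s z≤n) (ℕ.s≤s⁻¹ (2<p 0<e))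
      p^l*d≤δ : ∀ l → l < R → p ^ℕ l *ℕ d < p ^ℕ R → p ^ℕ l *ℕ d ≤ δ l
      p^l*d≤δ l _ <q = ℕₚ.≤-reflexive (Exact-unique (Exact-^ (p ^ℕ l) ex) (δ-Exact l)
        (ℕ.s≤s⁻¹ (≡.subst (p ^ℕ l *ℕ d <_) q≡1+Q <q)) (ℕₚ.≤-trans (δ≤m l) m≤Q))

  degree≡1⇒id : ∀ {f} → Normalised f → Exact 1 f → ∀ x → f x ≈ x
  degree≡1⇒id {f} f-norm (a , h , _ , add-term {h = h₀} b (no-terms h₀≈0) h≈ , f≈) x = begin
    f x          ≈⟨ f-affine x ⟩
    b + a * x    ≈⟨ +-cong b≈0 (*-congʳ a≈1) ⟩
    0# + 1# * x  ≈⟨ trans (+-identityˡ _) (*-identityˡ x) ⟩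
    x            ∎
    where
    open Normalised f-norm
    f-affine : ∀ x → f x ≈ b + a * x
    f-affine x = begin
      f x                              ≈⟨ f≈ x ⟩
      h x + a * (x * 1#)               ≈⟨ +-cong (h≈ x) (*-congˡ (*-identityʳ x)) ⟩
      (h₀ x + b * 1#) + a * x          ≈⟨ +-congʳ (+-cong (h₀≈0 x) (*-identityʳ b)) ⟩
      (0# + b) + a * x                 ≈⟨ +-congʳ (+-identityˡ b) ⟩
      b + a * x                        ∎
    b≈0 : b ≈ 0#
    b≈0 = begin
      b            ≈⟨ +-identityʳ b ⟨
      b + 0#       ≈⟨ +-congˡ (zeroʳ a) ⟨
      b + a * 0#   ≈⟨ f-affine 0# ⟨
      f 0#         ≈⟨ f0≈0 ⟩
      0#           ∎
    a≈1 : a ≈ 1#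
    a≈1 = begin
      a            ≈⟨ *-identityʳ a ⟨
      a * 1#       ≈⟨ +-identityˡ _ ⟨
      0# + a * 1#  ≈⟨ +-congʳ b≈0 ⟨
      b + a * 1#   ≈⟨ f-affine 1# ⟨
      f 1#         ≈⟨ f1≈1 ⟩
      1#           ∎

  -- Descent on the degree, with `n` as a bound for termination: if some f^(p^l) has smaller degree
  -- it replaces `f`, and the exponents l add up. When no such l < R exists, `f` has degree 1 and is
  -- the identity.
  inverse-frobenius : ∀ n {f d} → Normalised f → 1 ≤ d → d ≤ m → Exact d f → d < n →
                      ∃ λ s → ∀ x → f x ^ (p ^ℕ s) ≈ x
  inverse-frobenius (suc n) {f} {d} f-norm 1≤d d≤m ex (s≤s d≤n) =
    [ is-id , descend ]′ (first-crossing (λ l → d ≤ δ f-norm l) (λ l → d ℕ.≤? δ f-norm l) R)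
    where
    is-id : (∀ l → l < R → d ≤ δ f-norm l) → ∃ λ s → ∀ x → f x ^ (p ^ℕ s) ≈ x
    is-id d≤δ = 0 , λ x → trans (*-identityʳ (f x))
      (degree≡1⇒id f-norm (≡.subst (λ d → Exact d f) (minimal-degree≡1 f-norm 1≤d d≤m ex d≤δ) ex) x)
    descend : (∃ λ l → l < R × ¬ d ≤ δ f-norm l × (∀ l′ → l′ < l → d ≤ δ f-norm l′)) →
              ∃ λ s → ∀ x → f x ^ (p ^ℕ s) ≈ x
    descend (l , _ , d≰δ , _) = l +ℕ proj₁ rec , λ x → trans (^p^-+ (f x) l (proj₁ rec)) (proj₂ rec x)
      where
      rec : ∃ λ s → ∀ x → (f x ^ (p ^ℕ l)) ^ (p ^ℕ s) ≈ x
      rec = inverse-frobenius n (Normalised-^p^l f-norm l) (1≤δ f-norm l) (δ≤m f-norm l) (δ-Exact f-norm l)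
              (ℕₚ.<-≤-trans (ℕₚ.≰⇒> d≰δ) d≤n)

  Normalised⇒inverse-frobenius : ∀ {f} → Normalised f → ∃ λ s → ∀ x → f x ^ (p ^ℕ s) ≈ x
  Normalised⇒inverse-frobenius {f} f-norm = go (degree f-norm)
    where
    go : (∃ λ d → 1 ≤ d × d ≤ m × Exact d f) → ∃ λ s → ∀ x → f x ^ (p ^ℕ s) ≈ x
    go (d , 1≤d , d≤m , ex) = inverse-frobenius (suc d) f-norm 1≤d d≤m ex (ℕₚ.n<1+n d)

-- Automorphisms, class-preserving bijections and the generated group coincide.

module AutomorphismGroup {c ℓ : Level} (F : CommutativeRing c ℓ) (isField : IsField F) {k e R : ℕ} (p-prime : Prime (suc (k *ℕ e)))
                         (size : HasSize F (suc (k *ℕ e) ^ℕ R)) (2≤k : 2 ≤ k)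
                         (ω : CommutativeRing.Carrier F) (generates : IsPrimitive F ω) where
  open FrobeniusRigidity F isField {k} {e} {R} p-prime size 2≤k ω generates public

  ClassPreserving : (Carrier → Carrier) → Set (c ⊔ ℓ)
  ClassPreserving f = Bijection f × (∀ x y → (f x - f y) ^ m ≈ (x - y) ^ m)

  IsAut⇒ClassPreserving : ∀ {f} → IsAut f → ClassPreserving f
  IsAut⇒ClassPreserving {f} (f-cong , (g , g-cong , g∘f , f∘g) , f-adj) = f-bij , class-preserving f-bij
    -- `Adj u v` refers to v - u, so x - y belongs to the pair from y to x.
    (λ x y → (λ s → Adj⇒^m≈1 (proj₁ (f-adj y x) (^m≈1⇒Adj s))) , (λ s → Adj⇒^m≈1 (proj₂ (f-adj y x) (^m≈1⇒Adj s))))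
    where
    f-bij : Bijection f
    f-bij = record { f-cong = f-cong ; f⁻¹ = g ; f⁻¹-cong = g-cong ; f⁻¹∘f = g∘f ; f∘f⁻¹ = f∘g }

  ClassPreserving⇒IsAut : ∀ {f} → ClassPreserving f → IsAut f
  ClassPreserving⇒IsAut {f} (f-bij , class) = f-cong , (f⁻¹ , f⁻¹-cong , f⁻¹∘f , f∘f⁻¹) , λ u v →
    (λ adj → ^m≈1⇒Adj (trans (class v u) (Adj⇒^m≈1 adj))) , (λ adj → ^m≈1⇒Adj (trans (sym (class v u)) (Adj⇒^m≈1 adj)))
    where open Bijection f-bij

  pow-S : ∀ j → pow F ω (j *ℕ k) ^ m ≈ 1#
  pow-S j = S⇒^m≈1 (j , refl)

  translation-ClassPreserving : ∀ a → ClassPreserving (λ v → v + a)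
  translation-ClassPreserving a =
    record { f-cong = λ _ _ → +-congʳ ; f⁻¹ = λ v → v - a ; f⁻¹-cong = λ _ _ → +-congʳ
           ; f⁻¹∘f = λ x → [x+y]-y≈x x a ; f∘f⁻¹ = λ x → [x-y]+y≈x x a } ,
    λ x y → ^-congˡ m (begin
      (x + a) - (y + a)          ≈⟨ +-congˡ (-‿+-comm y a) ⟨
      (x + a) + (- y - a)        ≈⟨ solve 4 (λ x a y b → (x :+ a) :+ (y :+ b) := ((x :+ y) :+ a) :+ b) refl x a (- y) (- a) ⟩
      ((x - y) + a) - a          ≈⟨ [x+y]-y≈x (x - y) a ⟩
      x - y                      ∎)

  multiplication-ClassPreserving : ∀ {s} → s ^ m ≈ 1# → ClassPreserving (λ v → v * s)
  multiplication-ClassPreserving {s} s^m≈1 =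
    record { f-cong = λ _ _ → *-congʳ ; f⁻¹ = λ v → v * s⁻¹ ; f⁻¹-cong = λ _ _ → *-congʳ
           ; f⁻¹∘f = λ x → cancel x s s⁻¹ inv ; f∘f⁻¹ = λ x → cancel x s⁻¹ s (trans (*-comm s⁻¹ s) inv) } ,
    λ x y → begin
      (x * s - y * s) ^ m        ≈⟨ ^-congˡ m (+-congˡ (-‿distribˡ-* y s)) ⟩
      (x * s + (- y) * s) ^ m    ≈⟨ ^-congˡ m (distribʳ s x (- y)) ⟨
      ((x - y) * s) ^ m          ≈⟨ ^-distrib-* (x - y) s m ⟩
      (x - y) ^ m * s ^ m        ≈⟨ *-congˡ s^m≈1 ⟩
      (x - y) ^ m * 1#           ≈⟨ *-identityʳ _ ⟩
      (x - y) ^ m                ∎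
    where
    s⁻¹ = proj₁ (proj₂ isField s (^m≈1⇒≉0 s^m≈1))
    inv : s * s⁻¹ ≈ 1#
    inv = proj₂ (proj₂ isField s (^m≈1⇒≉0 s^m≈1))
    cancel : ∀ x u v → u * v ≈ 1# → (x * u) * v ≈ x
    cancel x u v uv≈1 = trans (*-assoc x u v) (trans (*-congˡ uv≈1) (*-identityʳ x))

  InGroup⇒ClassPreserving : ∀ {f} → InGroup p f → ClassPreserving f
  InGroup⇒ClassPreserving (translation a) = translation-ClassPreserving a
  InGroup⇒ClassPreserving mulωk = multiplication-ClassPreserving (trans (^-congˡ m (reflexive (≡.cong (pow F ω) (≡.sym (ℕₚ.*-identityˡ k))))) (pow-S 1))
  InGroup⇒ClassPreserving frobenius =
    record { f-cong = λ x y eq → trans (pow≈^p x) (trans (^-congˡ p eq) (sym (pow≈^p y)))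
           ; f⁻¹ = f⁻¹ ; f⁻¹-cong = f⁻¹-cong
           ; f⁻¹∘f = λ x → trans (f⁻¹-cong _ _ (pow≈^p¹ x)) (f⁻¹∘f x)
           ; f∘f⁻¹ = λ x → trans (pow≈^p¹ (f⁻¹ x)) (f∘f⁻¹ x) } ,
    λ x y → begin
      (pow F x p - pow F y p) ^ m    ≈⟨ ^-congˡ m (+-‿cong (pow≈^p x) (pow≈^p y)) ⟩
      (x ^ p - y ^ p) ^ m            ≈⟨ ^-congˡ m (frobenius-- x y) ⟨
      ((x - y) ^ p) ^ m              ≈⟨ [z^p]^m≈z^m (x - y) ⟩
      (x - y) ^ m                    ∎
    where
    open Bijection (^p^l-bijection 1)
    pow≈^p : ∀ x → pow F x p ≈ x ^ p
    pow≈^p x = reflexive (pow≡^ x p)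
    pow≈^p¹ : ∀ x → pow F x p ≈ x ^ (p ^ℕ 1)
    pow≈^p¹ x = trans (pow≈^p x) (^-congʳ x (≡.sym (ℕₚ.*-identityʳ p)))
  InGroup⇒ClassPreserving (compose {f} {g} f∈ g∈) =
    ∘-bijection (proj₁ (InGroup⇒ClassPreserving f∈)) (proj₁ (InGroup⇒ClassPreserving g∈)) ,
    λ x y → trans (proj₂ (InGroup⇒ClassPreserving f∈) (g x) (g y)) (proj₂ (InGroup⇒ClassPreserving g∈) x y)
  InGroup⇒ClassPreserving (inverse {g} {h} g∈ h-cong h∘g g∘h) =
    record { f-cong = h-cong ; f⁻¹ = g ; f⁻¹-cong = Bijection.f-cong (proj₁ (InGroup⇒ClassPreserving g∈)) ; f⁻¹∘f = g∘h ; f∘f⁻¹ = h∘g } ,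
    λ x y → begin
      (h x - h y) ^ m              ≈⟨ proj₂ (InGroup⇒ClassPreserving g∈) (h x) (h y) ⟨
      (g (h x) - g (h y)) ^ m      ≈⟨ ^-congˡ m (+-‿cong (g∘h x) (g∘h y)) ⟩
      (x - y) ^ m                  ∎
  InGroup⇒ClassPreserving (extensional {g} {h} g∈ g≈h) =
    record { f-cong = λ x y eq → trans (sym (g≈h x)) (trans (f-cong x y eq) (g≈h y))
           ; f⁻¹ = f⁻¹ ; f⁻¹-cong = f⁻¹-cong
           ; f⁻¹∘f = λ x → trans (f⁻¹-cong _ _ (sym (g≈h x))) (f⁻¹∘f x)
           ; f∘f⁻¹ = λ x → trans (sym (g≈h (f⁻¹ x))) (f∘f⁻¹ x) } ,
    λ x y → trans (^-congˡ m (+-‿cong (sym (g≈h x)) (sym (g≈h y)))) (proj₂ (InGroup⇒ClassPreserving g∈) x y)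
    where open Bijection (proj₁ (InGroup⇒ClassPreserving g∈))

  frobenius-iterate : ∀ s → InGroup p (λ v → v ^ (p ^ℕ s))
  -- The identity is obtained as the translation by 0.
  frobenius-iterate zero    = extensional (translation 0#) (λ v → trans (+-identityʳ v) (sym (*-identityʳ v)))
  frobenius-iterate (suc s) = extensional (compose (frobenius-iterate s) frobenius)
    (λ v → trans (^-congˡ (p ^ℕ s) (reflexive (pow≡^ v p))) (sym (^p^-suc v s)))

  multiplication : ∀ j → InGroup p (λ v → v * pow F ω (j *ℕ k))
  multiplication zero    = extensional (translation 0#) (λ v → trans (+-identityʳ v) (sym (*-identityʳ v)))
  multiplication (suc j) = extensional (compose mulωk (multiplication j)) (λ v → begin
    (v * pow F ω (j *ℕ k)) * pow F ω k   ≈⟨ *-cong (*-congˡ (reflexive (pow≡^ ω (j *ℕ k)))) (reflexive (pow≡^ ω k)) ⟩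
    (v * ω ^ (j *ℕ k)) * ω ^ k           ≈⟨ solve 3 (λ v x y → (v :* x) :* y := v :* (y :* x)) refl v (ω ^ (j *ℕ k)) (ω ^ k) ⟩
    v * (ω ^ k * ω ^ (j *ℕ k))           ≈⟨ *-congˡ (^-homo-* ω k (j *ℕ k)) ⟨
    v * ω ^ (k +ℕ j *ℕ k)                ≈⟨ *-congˡ (reflexive (pow≡^ ω (k +ℕ j *ℕ k))) ⟨
    v * pow F ω (k +ℕ j *ℕ k)            ∎)

  Normalised⇒InGroup : ∀ {f} → Normalised f → InGroup p f
  Normalised⇒InGroup {f} f-norm with s , f^≈ ← Normalised⇒inverse-frobenius f-norm =
    inverse (frobenius-iterate s) f-cong
      (λ x → begin
        f (x ^ (p ^ℕ s))               ≈⟨ f-cong _ _ (^-congˡ (p ^ℕ s) (f∘f⁻¹ x)) ⟨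
        f (f (f⁻¹ x) ^ (p ^ℕ s))       ≈⟨ f-cong _ _ (f^≈ (f⁻¹ x)) ⟩
        f (f⁻¹ x)                      ≈⟨ f∘f⁻¹ x ⟩
        x                              ∎)
      f^≈
    where open Normalised f-norm

  -- The element s = f 1 - f 0 satisfies s^m = (1 - 0)^m = 1 and is thus a power of ω^k. Subtracting
  -- f 0 and dividing by s normalises `f`, and undoing both uses a multiplication and a translation
  -- of the group.
  ClassPreserving⇒InGroup : ∀ {f} → ClassPreserving f → InGroup p f
  ClassPreserving⇒InGroup {f} (f-bij , class) =
    extensional (compose (translation (f 0#)) (compose (multiplication j) (Normalised⇒InGroup normalised))) λ x → begin
      ((f x - f 0#) * s⁻¹) * pow F ω (j *ℕ k) + f 0#   ≈⟨ +-congʳ (*-congˡ (proj₂ s∈S)) ⟨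
      ((f x - f 0#) * s⁻¹) * s + f 0#                  ≈⟨ +-congʳ (*-assoc (f x - f 0#) s⁻¹ s) ⟩
      (f x - f 0#) * (s⁻¹ * s) + f 0#                  ≈⟨ +-congʳ (*-congˡ (trans (*-comm s⁻¹ s) inv)) ⟩
      (f x - f 0#) * 1# + f 0#                         ≈⟨ +-congʳ (*-identityʳ _) ⟩
      (f x - f 0#) + f 0#                              ≈⟨ [x-y]+y≈x (f x) (f 0#) ⟩
      f x                                              ∎
    where
    s = f 1# - f 0#
    s^m≈1 : s ^ m ≈ 1#
    s^m≈1 = begin
      (f 1# - f 0#) ^ m     ≈⟨ class 1# 0# ⟩
      (1# - 0#) ^ m         ≈⟨ ^-congˡ m (trans (+-congˡ -0#≈0#) (+-identityʳ 1#)) ⟩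
      1# ^ m                ≈⟨ 1^n≈1 m ⟩
      1#                    ∎
    s∈S : ∃ λ j → s ≈ pow F ω (j *ℕ k)
    s∈S = ^m≈1⇒S s^m≈1
    j = proj₁ s∈S
    s⁻¹ = proj₁ (proj₂ isField s (^m≈1⇒≉0 s^m≈1))
    inv : s * s⁻¹ ≈ 1#
    inv = proj₂ (proj₂ isField s (^m≈1⇒≉0 s^m≈1))
    s⁻¹^m≈1 : s⁻¹ ^ m ≈ 1#
    s⁻¹^m≈1 = begin
      s⁻¹ ^ m            ≈⟨ *-identityˡ _ ⟨
      1# * s⁻¹ ^ m       ≈⟨ *-congʳ s^m≈1 ⟨
      s ^ m * s⁻¹ ^ m    ≈⟨ ^-distrib-* s s⁻¹ m ⟨
      (s * s⁻¹) ^ m      ≈⟨ trans (^-congˡ m inv) (1^n≈1 m) ⟩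
      1#                 ∎
    scaling    = multiplication-ClassPreserving s⁻¹^m≈1
    shift      = translation-ClassPreserving (- f 0#)
    normalised : Normalised (λ x → (f x - f 0#) * s⁻¹)
    normalised = record
      { bijection = ∘-bijection (proj₁ scaling) (∘-bijection (proj₁ shift) f-bij)
      ; f0≈0      = trans (*-congʳ (-‿inverseʳ (f 0#))) (zeroˡ s⁻¹)
      ; f1≈1      = inv
      ; class     = λ x y → begin
          ((f x - f 0#) * s⁻¹ - (f y - f 0#) * s⁻¹) ^ m   ≈⟨ proj₂ scaling (f x - f 0#) (f y - f 0#) ⟩
          ((f x - f 0#) - (f y - f 0#)) ^ m               ≈⟨ proj₂ shift (f x) (f y) ⟩
          (f x - f y) ^ m                                 ≈⟨ class x y ⟩
          (x - y) ^ m                                     ∎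
      }

  -- Here `p` is an odd prime because p > 2; cancelling `k` in 2k ∣ q - 1 = k m leaves the claim.
  2∣m : (¬ (2 ∣ p) → (2 *ℕ k) ∣ (p ^ℕ R ∸ 1)) → 2 ∣ m
  2∣m 2k∣ = *-cancelˡ-∣ k {{ℕ.>-nonZero (ℕₚ.<-trans (s≤s z≤n) 2≤k)}}
    (≡.subst₂ _∣_ (ℕₚ.*-comm 2 k) (≡.trans (≡.cong (_∸ 1) q≡1+Q) Q≡k*m) (2k∣ p-odd))
    where
    p-odd : ¬ (2 ∣ p)
    p-odd 2∣p with prime⇒irreducible p-prime 2∣p
    ... | inj₁ ()
    ... | inj₂ 2≡p = ℕₚ.<⇒≢ (2<p 0<e) 2≡p

open import Data.Nat using (_^_; _*_)

theorem3p8 : ∀ {c ℓ : Level} (p R k : ℕ) → Prime p → R ≥ 1 → k ≥ 2 → k ∣ (p ∸ 1)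
    → (¬ (2 ∣ p) → (2 * k) ∣ (p ^ R ∸ 1))
    → (F : CommutativeRing c ℓ) → IsField F → HasSize F (p ^ R)
    → (ω : CommutativeRing.Carrier F) → IsPrimitive F ω
    → GPaley.Connected F ω k
    × (∀ f → (GPaley.IsAut F ω k f → GPaley.InGroup F ω k p f)
    × (GPaley.InGroup F ω k p f → GPaley.IsAut F ω k f))
theorem3p8 zero    R k p-prime = contradiction p-prime ¬prime[0]
theorem3p8 (suc d) R k p-prime _ 2≤k (divides e d≡e*k) 2k∣ F isField size ω generates with ≡.trans d≡e*k (ℕₚ.*-comm e k)
-- Matching rewrites `p` as 1 + k e, the form in which all the modules take it.
... | ≡.refl = connected (2∣m 2k∣) , λ f →
  (λ aut → ClassPreserving⇒InGroup (IsAut⇒ClassPreserving aut)) ,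
  (λ f∈ → ClassPreserving⇒IsAut (InGroup⇒ClassPreserving f∈))
  where open AutomorphismGroup F isField {k} {e} {R} p-prime size 2≤k ω generates
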